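{- MB Dom Game has a linear kernel when parameterized by the neighborhood diversity of the input graph.
   Context: All graphs are finite, simple and undirected. The Maker-Breaker domination game on a graph $G$ is played by Dominator and Staller, who alternately claim one unclaimed vertex of $G$. Dominator wins if the vertices she claims contain a dominating set of $G$; otherwise Staller wins. MB Dom Game is the problem: given a graph $G$ and the first player (Dominator or Staller), decide which player has a winning strategy in the Maker-Breaker domination game on $G$ with the given player moving first. Two vertices $u,v$ have the same type if $\{u,v\}$ is a module, i.e. $N(u)\setminus\{v\}=N(v)\setminus\{u\}$. The neighborhood diversity of $G=(V,E)$ is the minimum integer $w$ such that $V$ can be partitioned into $w$ sets $V_1,\dots,V_w$, each $V_i$ being a set of vertices of the same type, i.e. a module inducing either a clique or a stable set. A linear kernel for a problem with parameter $w$ is a polynomial-time algorithm transforming every instance into an equivalent instance of the same problem (same winner) whose graph has $O(w)$ vertices. -}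

module Defs where

open import Data.Bool.Base using (Bool; true; false)
open import Data.Fin.Base using (Fin; zero)
open import Data.Fin.Subset using (Subset; _∈_; _∉_; _-_)
open import Data.Maybe.Base using (Maybe; just; nothing)
open import Data.Nat.Base using (ℕ; zero; suc; _+_; _*_; _^_; _≤_)
open import Data.Product.Base using (Σ-syntax; ∃-syntax; _×_)
open import Data.Sum.Base using (_⊎_)
open import Data.Vec.Base
  using (Vec; []; _∷_; lookup; replicate; tabulate; foldr′; map; _[_]≔_)
open import Function.Bundles using (_⇔_)
open import Function.Definitions using (StrictlySurjective)
open import Relation.Nullary.Negation.Core using (¬_)
open import Relation.Binary.PropositionalEquality.Core using (_≡_; _≢_)

------------------------------------------------------------------------
-- Graphs and neighborhood diversity

record Graph (n : ℕ) : Set where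
  field
    N           : Fin n → Subset n
    symmetric   : ∀ {u v} → u ∈ N v → v ∈ N u
    irreflexive : ∀ {v} → v ∉ N v

open Graph public

Dominating : ∀ {n} → Graph n → Subset n → Set
Dominating G D = ∀ v → v ∈ D ⊎ ∃[ u ] (u ∈ D × u ∈ N G v)

-- _-_ removes a vertex from a set.
SameType : ∀ {n} → Graph n → Fin n → Fin n → Set
SameType G u v = N G u - v ≡ N G v - u

-- A partition of the vertices into w nonempty parts, given by the map sending
-- each vertex to the index of its part.
record TypePartition {n} (G : Graph n) (w : ℕ) : Set where
  field
    part     : Fin n → Fin w
    nonempty : StrictlySurjective _≡_ part
    sameType : ∀ u v → part u ≡ part v → SameType G u v

IsNeighborhoodDiversity : ∀ {n} → Graph n → ℕ → Set
IsNeighborhoodDiversity G w =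
  TypePartition G w × (∀ w′ → TypePartition G w′ → w ≤ w′)

------------------------------------------------------------------------
-- The Maker-Breaker domination game

data Player : Set where
  dominator staller : Player

opponent : Player → Player
opponent dominator = staller
opponent staller   = dominator

-- Who has claimed each vertex, if anybody.
Position : ℕ → Set
Position n = Vec (Maybe Player) n

Free : ∀ {n} → Position n → Fin n → Set
Free p v = lookup p v ≡ nothing

DominatorDominates : ∀ {n} → Graph n → Position n → Set
DominatorDominates {n} G p =
  Σ[ D ∈ Subset n ] ((∀ {v} → v ∈ D → lookup p v ≡ just dominator) × Dominating G D)

WonBy : ∀ {n} → Graph n → Player → Position n → Set
WonBy G dominator p = DominatorDominates G p
WonBy G staller   p = ¬ DominatorDominates G p

-- Strategy G P Q p is the type of winning strategies of P from position p with
-- Q to move: trees that fix one move wherever P is to move, and branch over all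
-- moves of the opponent, so that every play ends in a full board won by P.
-- The vertex required by reply keeps a full board from counting as won by
-- whoever is not to move.
data Strategy {n} (G : Graph n) (P : Player) : Player → Position n → Set where
  over  : ∀ {Q p} → (∀ v → ¬ Free p v) → WonBy G P p → Strategy G P Q p
  move  : ∀ {Q p} → Q ≡ P → ∀ v → Free p v →
          Strategy G P (opponent Q) (p [ v ]≔ just Q) →
          Strategy G P Q p
  reply : ∀ {Q p} → Q ≢ P → ∃[ v ] Free p v →
          (∀ v → Free p v → Strategy G P (opponent Q) (p [ v ]≔ just Q)) →
          Strategy G P Q p

record Instance : Set where
  field
    order : ℕ
    graph : Graph order
    first : Player

open Instance public

HasWinningStrategy : Player → Instance → Set
HasWinningStrategy P I = Strategy (graph I) P (first I) (replicate (order I) nothing)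

SameWinner : Instance → Instance → Set
SameWinner I J = ∀ P → HasWinningStrategy P I ⇔ HasWinningStrategy P J

------------------------------------------------------------------------
-- Polynomial time

-- The machine model is Jones's WHILE language over binary trees, for a fixed
-- number k of variables. Every operation has unit cost; in particular cons, hd,
-- tl and assignment act on pointers.
data Tree : Set where
  nil  : Tree
  cons : Tree → Tree → Tree

size : Tree → ℕ
size nil        = 1
size (cons s t) = suc (size s + size t)

Store : ℕ → Set
Store k = Vec Tree k

data Expr (k : ℕ) : Set where
  var   : Fin k → Expr k
  nil   : Expr k
  cons  : Expr k → Expr k → Expr k
  hd tl : Expr k → Expr k

head tail : Tree → Tree
head nil        = nil
head (cons s t) = s
tail nil        = nil
tail (cons s t) = t

eval : ∀ {k} → Expr k → Store k → Tree
eval (var x)    σ = lookup σ x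
eval nil        σ = nil
eval (cons e f) σ = cons (eval e σ) (eval f σ)
eval (hd e)     σ = head (eval e σ)
eval (tl e)     σ = tail (eval e σ)

cost : ∀ {k} → Expr k → ℕ
cost (var x)    = 1
cost nil        = 1
cost (cons e f) = suc (cost e + cost f)
cost (hd e)     = suc (cost e)
cost (tl e)     = suc (cost e)

infix  6 _≔_
infixr 5 _⨾_

data Command (k : ℕ) : Set where
  _≔_           : Fin k → Expr k → Command k
  _⨾_           : Command k → Command k → Command k
  if_then_else_ : Expr k → Command k → Command k → Command k
  while_loop_   : Expr k → Command k → Command k

-- Run C σ t τ: started in store σ, C halts after t steps in store τ.
-- As a condition, nil is false and every other tree is true.
data Run {k} : Command k → Store k → ℕ → Store k → Set where
  assign     : ∀ {x e σ} → Run (x ≔ e) σ (suc (cost e)) (σ [ x ]≔ eval e σ)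
  seq        : ∀ {C D σ τ υ s t} → Run C σ s τ → Run D τ t υ →
               Run (C ⨾ D) σ (s + t) υ
  if-true    : ∀ {e C D σ τ t} → eval e σ ≢ nil → Run C σ t τ →
               Run (if e then C else D) σ (suc (cost e + t)) τ
  if-false   : ∀ {e C D σ τ t} → eval e σ ≡ nil → Run D σ t τ →
               Run (if e then C else D) σ (suc (cost e + t)) τ
  loop-again : ∀ {e C σ τ υ s t} → eval e σ ≢ nil → Run C σ s τ →
               Run (while e loop C) τ t υ →
               Run (while e loop C) σ (suc (cost e + (s + t))) υ
  loop-exit  : ∀ {e C σ} → eval e σ ≡ nil →
               Run (while e loop C) σ (suc (cost e)) σ

-- The input is passed in variable zero, all other variables being nil, and the
-- output is read off variable zero. Unit-cost cons can share subtrees and so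
-- build an exponentially large tree; the size of the output is therefore
-- charged as well, as the cost of writing it out.
PolynomialTime : {A B : Set} → (A → Tree) → (B → Tree) → (A → B) → Set
PolynomialTime encodeA encodeB f =
  ∃[ k ] Σ[ C ∈ Command (suc k) ] ∃[ a ] ∃[ d ] (∀ x →
    ∃[ t ] Σ[ τ ∈ Store (suc k) ]
      ( Run C (encodeA x ∷ replicate k nil) t τ
      × lookup τ zero ≡ encodeB (f x)
      × t + size (encodeB (f x)) ≤ a * size (encodeA x) ^ d ))

encodeBool : Bool → Tree
encodeBool false = nil
encodeBool true  = cons nil nil

encodePlayer : Player → Tree
encodePlayer dominator = nil
encodePlayer staller   = cons nil nil

encodeList : ∀ {n} → Vec Tree n → Tree
encodeList = foldr′ cons nil

-- The first player, followed by the rows of the adjacency matrix.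
encode : Instance → Tree
encode I = cons (encodePlayer (first I))
  (encodeList (tabulate λ v → encodeList (map encodeBool (N (graph I) v))))

{-# OPTIONS --safe #-}
module Submission where

-- The kernel deletes every vertex that has two later vertices of its own type,
-- so each part of a partition into types keeps at most two vertices.
--
-- Let T be a set of at least two vertices of the same type. Once each player
-- owns a vertex of T, it no longer matters who owns the others: an outside
-- vertex adjacent to T is dominated, a vertex of T is dominated by T if T is a
-- clique, and otherwise one of them belongs to Staller, so that the common
-- neighborhood of T has to meet Dominator's set. Each player can make sure of a
-- vertex of T, by answering there when the opponent first plays there, and an
-- additional move never hurts. Hence the outcome is that of the game in which T
-- is already claimed by both players, and this game is the same for T and for T
-- minus a third vertex. By determinacy it suffices to carry winning strategies
-- from the latter game to the former ones.
--
-- The program is composed of polynomial-time functions on trees, represented by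
-- code that acts on the top of a stack held in a single variable.

open import Defs
open import Data.Bool.Base using (Bool; true; false; not; _∧_; _∨_)
import Data.Bool.Base as Bool
import Data.Bool.Properties as Bool
open import Data.Fin.Base using (Fin; zero; suc; toℕ; fromℕ<; combine)
import Data.Fin.Base as Fin
import Data.Fin.Properties as Fin
open import Data.Fin.Subset using (Subset; _∈_; _∉_; _⊆_; _-_; ⁅_⁆; ∣_∣)
open import Data.Fin.Subset.Properties
  using (_∈?_; x∈p∧x≢y⇒x∈p-y; p─q⊆p; p─q─q≡p─q; x∈p⇒p-x⊂p; ⊂-irref; ⊆-antisym)
open import Data.Maybe.Base using (Maybe; just; nothing)
import Data.Maybe.Properties as Maybe
open import Data.Nat.Base using (ℕ; zero; suc; _+_; _*_; _^_; _≤_; _<_; z≤n; s≤s)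
open import Data.Nat.Properties
  using ( ≤-refl; ≤-reflexive; ≤-trans; <⇒≤; <-irrefl; m≤n⇒m<n∨m≡n; n≤1+n; m≤m+n; m≤n+m
        ; +-assoc; +-comm; +-mono-≤; +-monoˡ-≤; +-monoʳ-≤
        ; *-assoc; *-comm; *-identityˡ; *-identityʳ; *-distribʳ-+; [m*n]*[o*p]≡[m*o]*[n*p]
        ; *-mono-≤; *-monoˡ-≤; *-monoʳ-≤
        ; ^-distribˡ-+-*; ^-*-assoc; ^-monoʳ-≤; m^n>0; module ≤-Reasoning)
open import Data.Nat.Solver using (module +-*-Solver)
open import Data.Product.Base using (Σ-syntax; ∃-syntax; _×_; _,_; proj₁; proj₂)
open import Data.Sum.Base using (_⊎_; inj₁; inj₂; [_,_]′)
import Data.Sum.Base as Sum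
open import Data.Vec.Base
  using ([]; _∷_; lookup; replicate; tabulate; map; _[_]≔_)
open import Data.Vec.Properties
  using ( lookup∘update; lookup∘update′; []≔-commutes; lookup-replicate; []=⇒lookup; lookup⇒[]=
        ; lookup∘tabulate; tabulate∘lookup; tabulate-cong; tabulate-∘)
open import Function.Base using (_∘_; id)
open import Function.Bundles using (mk⇔)
open import Relation.Binary.Definitions using (tri<; tri≈; tri>)
open import Relation.Binary.PropositionalEquality
  using (_≡_; _≢_; refl; sym; trans; cong; cong₂; subst; ≢-sym; module ≡-Reasoning)
open import Relation.Nullary.Decidable.Core
  using (Dec; yes; no; does; _×-dec_; _⊎-dec_; _→-dec_)
open import Relation.Nullary.Negation.Core using (¬_; contradiction)
open +-*-Solver using (solve; _:=_; _:+_; _:*_; con)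

private variable
  n : ℕ
  P Q : Player
  f g h r l : Tree → Tree

-- Maker-Breaker games

Claimed : Player → Position n → Fin n → Set
Claimed P p v = lookup p v ≡ just P

Full : Position n → Set
Full p = ∀ v → ¬ Free p v

opponent-involutive : ∀ P → opponent (opponent P) ≡ P
opponent-involutive dominator = refl
opponent-involutive staller   = refl

#free : Position n → ℕ
#free []            = 0
#free (nothing ∷ p) = suc (#free p)
#free (just _ ∷ p)  = #free p

#free-claim : ∀ (p : Position n) v → Free p v → #free p ≡ suc (#free (p [ v ]≔ just Q))
#free-claim (nothing ∷ p) zero    _  = refl
#free-claim (nothing ∷ p) (suc v) fr = cong suc (#free-claim p v fr)
#free-claim (just _ ∷ p)  (suc v) fr = #free-claim p v fr

claim-≤ : ∀ {k} (p : Position n) v → Free p v → #free p ≤ suc k → #free (p [ v ]≔ just Q) ≤ k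
claim-≤ {Q = Q} p v fr le with #free p | #free-claim {Q = Q} p v fr
claim-≤ p v fr (s≤s le) | _ | refl = le

claim-≰0 : ∀ (p : Position n) v → Free p v → ¬ #free p ≤ 0
claim-≰0 p v fr le with #free p | #free-claim {Q = dominator} p v fr
claim-≰0 p v fr () | _ | refl

full? : (p : Position n) → Full p ⊎ ∃[ v ] Free p v
full? p with Fin.any? {P = Free p} (λ v → free? (lookup p v))
  where
  free? : (m : Maybe Player) → Dec (m ≡ nothing)
  free? nothing  = yes refl
  free? (just _) = no λ ()
... | yes ∃free = inj₂ ∃free
... | no  ∄free = inj₁ λ v fr → ∄free (v , fr)

claimed-not-free : ∀ (p : Position n) {v} → Claimed P p v → ¬ Free p v
claimed-not-free p cl fr with () ← trans (sym cl) fr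

free-weaken : ∀ (p : Position n) v w → Free (p [ v ]≔ just Q) w → w ≢ v × Free p w
free-weaken p v w fr with w Fin.≟ v
... | yes refl = contradiction fr (claimed-not-free (p [ v ]≔ _) (lookup∘update v p _))
... | no  w≢v  = w≢v , trans (sym (lookup∘update′ w≢v p _)) fr

data Turn : Set where
  mine theirs : Turn

flip : Turn → Turn
flip mine   = theirs
flip theirs = mine

turn : Player → Player → Turn
turn dominator dominator = mine
turn dominator staller   = theirs
turn staller   dominator = theirs
turn staller   staller   = mine

Outcome : ℕ → Set₁
Outcome n = Player → Position n → Set

-- `Strategy` restated with the turn taken relative to `P` and with an arbitrary outcome, so that
-- one argument serves both players and also the modified games below.
data Win {n} (W : Outcome n) (P : Player) : Turn → Position n → Set where
  over  : ∀ {τ p} → Full p → W P p → Win W P τ p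
  move  : ∀ {p} v → Free p v → Win W P theirs (p [ v ]≔ just P) → Win W P mine p
  reply : ∀ {p} → ∃[ v ] Free p v →
          (∀ v → Free p v → Win W P mine (p [ v ]≔ just (opponent P))) →
          Win W P theirs p

fromStrategy : ∀ {G : Graph n} {p} → Strategy G P Q p → Win (WonBy G) P (turn P Q) p
fromStrategy                           (over full won)     = over full won
fromStrategy {P = dominator} {dominator} (move _ v fr s)    = move v fr (fromStrategy s)
fromStrategy {P = staller}   {staller}   (move _ v fr s)    = move v fr (fromStrategy s)
fromStrategy {P = dominator} {dominator} (reply Q≢P _ _)    = contradiction refl Q≢P
fromStrategy {P = staller}   {staller}   (reply Q≢P _ _)    = contradiction refl Q≢P
fromStrategy {P = dominator} {staller}   (reply _ ∃free s) =
  reply ∃free λ v fr → fromStrategy (s v fr)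
fromStrategy {P = staller}   {dominator} (reply _ ∃free s) =
  reply ∃free λ v fr → fromStrategy (s v fr)

toStrategy : ∀ {G : Graph n} {p} Q → Win (WonBy G) P (turn P Q) p → Strategy G P Q p
toStrategy {P = dominator} dominator (over full won) = over full won
toStrategy {P = dominator} dominator (move v fr s)   = move refl v fr (toStrategy staller s)
toStrategy {P = staller}   staller   (over full won) = over full won
toStrategy {P = staller}   staller   (move v fr s)   = move refl v fr (toStrategy dominator s)
toStrategy {P = dominator} staller   (over full won) = over full won
toStrategy {P = dominator} staller   (reply ∃free s) =
  reply (λ ()) ∃free λ v fr → toStrategy dominator (s v fr)
toStrategy {P = staller}   dominator (over full won) = over full won
toStrategy {P = staller}   dominator (reply ∃free s) =
  reply (λ ()) ∃free λ v fr → toStrategy staller (s v fr)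

Monotone : Outcome n → Set
Monotone W = ∀ P p v → W P (p [ v ]≔ just (opponent P)) → W P (p [ v ]≔ just P)

mutual
  -- `P` plays the old strategy as if `v` were still free. When that strategy asks for `v` itself,
  -- the move has already been made, and `tempo` spends the spare turn. The bound `k` on the free
  -- vertices drives the mutual induction.
  free-gift : ∀ {W : Outcome n} → Monotone W → ∀ k {p τ} v → #free p ≤ k → Free p v →
              Win W P τ p → Win W P τ (p [ v ]≔ just P)
  free-gift mono zero {p} v le fr _ = contradiction le (claim-≰0 p v fr)
  free-gift mono (suc k) v le fr (over full _) = contradiction fr (full v)
  free-gift {P = P} mono (suc k) {p} v le fr (move w fw s) with w Fin.≟ v
  ... | yes refl = tempo mono k (claim-≤ p v fr le) s
  ... | no  w≢v  =
    move w (trans (lookup∘update′ w≢v p _) fw)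
      (subst (Win _ _ theirs) ([]≔-commutes p w v w≢v)
        (free-gift mono k v (claim-≤ p w fw le) (trans (lookup∘update′ (≢-sym w≢v) p _) fr) s))
  free-gift {P = P} mono (suc k) {p} v le fr (reply _ s) with full? (p [ v ]≔ just P)
  -- `v` was the last free vertex. In the old play the opponent takes it and the play ends in a win
  -- of `P`; `mono` then hands the vertex over.
  ... | inj₁ full = over full (mono P p v (final (s v fr)))
    where
    final : Win _ P mine (p [ v ]≔ just (opponent P)) → _
    final (over _ won) = won
    final (move w fw _) with free-weaken p v w fw
    ... | w≢v , fw′ = contradiction (trans (lookup∘update′ w≢v p _) fw′) (full w)
  ... | inj₂ ∃free = reply ∃free λ w fw → let w≢v , fw′ = free-weaken p v w fw in
      subst (Win _ _ mine) ([]≔-commutes p w v w≢v)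
        (free-gift mono k v (claim-≤ p w fw′ le) (trans (lookup∘update′ (≢-sym w≢v) p _) fr)
          (s w fw′))

  -- An unexpected turn can be spent on any free vertex, since `free-gift` shows that owning it does
  -- no harm.
  tempo : ∀ {W : Outcome n} → Monotone W → ∀ k {p} → #free p ≤ k →
          Win W P theirs p → Win W P mine p
  tempo mono k {p} le s with full? p
  tempo mono k le (over full won)   | inj₁ _ = over full won
  tempo mono k le (reply (v , fr) _) | inj₁ full = contradiction fr (full v)
  tempo mono k le s | inj₂ (v , fr) = move v fr (free-gift mono k v le fr s)

-- Determinacy of finite games.

search : ∀ {A B : Fin n → Set} → (∀ v → A v ⊎ B v) → (∃[ v ] A v) ⊎ (∀ v → B v)
search {zero}  f = inj₂ λ ()
search {suc n} f with f zero | search (f ∘ suc)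
... | inj₁ a | _             = inj₁ (zero , a)
... | inj₂ _ | inj₁ (v , a)  = inj₁ (suc v , a)
... | inj₂ b | inj₂ bs       = inj₂ λ { zero → b ; (suc v) → bs v }

Decided : Outcome n → Set
Decided W = ∀ p → W dominator p ⊎ W staller p

Exclusive : Outcome n → Set
Exclusive W = ∀ p → W dominator p → ¬ W staller p

decided-for : ∀ {W : Outcome n} → Decided W → ∀ P p → W P p ⊎ W (opponent P) p
decided-for dec dominator p = dec p
decided-for dec staller   p = [ inj₂ , inj₁ ]′ (dec p)

-- Backward induction: either some move of `P` reaches a position won by `P`, or every move reaches
-- one won by the opponent. `search` makes this choice constructively.
determined-mine : ∀ {W : Outcome n} → Decided W → ∀ k {p} P → #free p ≤ k →
                  Win W P mine p ⊎ Win W (opponent P) theirs p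
determined-mine {W = W} dec k {p} P le with full? p
... | inj₁ full = [ inj₁ ∘ over full , inj₂ ∘ over full ]′ (decided-for {W = W} dec P p)
determined-mine dec zero    {p} P le | inj₂ (v , fr) = contradiction le (claim-≰0 p v fr)
determined-mine {W = W} dec (suc k) {p} P le | inj₂ ∃free
  with search {A = λ v → Free p v × Win W P theirs (p [ v ]≔ just P)}
              {B = λ v → Free p v →
                     Win W (opponent P) mine (p [ v ]≔ just (opponent (opponent P)))} try
  where
  try : ∀ v → Free p v × Win W P theirs (p [ v ]≔ just P) ⊎
              (Free p v → Win W (opponent P) mine (p [ v ]≔ just (opponent (opponent P))))
  try v with lookup p v in eq
  ... | just _  = inj₂ λ ()
  -- The stones in `B` belong to `opponent (opponent P)`, which equals `P` only propositionally.
  ... | nothing rewrite opponent-involutive P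
    with determined-mine dec k (opponent P) (claim-≤ {Q = P} p v eq le)
  ... | inj₁ w = inj₂ λ _ → w
  ... | inj₂ w rewrite opponent-involutive P = inj₁ (refl , w)
... | inj₁ (v , fr , w) = inj₁ (move v fr w)
... | inj₂ ws           = inj₂ (reply ∃free ws)

determined : ∀ {W : Outcome n} → Decided W → ∀ {p} P Q →
             Win W P (turn P Q) p ⊎ Win W (opponent P) (turn (opponent P) Q) p
determined dec dominator dominator = determined-mine dec _ dominator ≤-refl
determined dec staller   staller   = determined-mine dec _ staller ≤-refl
determined dec dominator staller   = [ inj₂ , inj₁ ]′ (determined-mine dec _ staller ≤-refl)
determined dec staller   dominator = [ inj₂ , inj₁ ]′ (determined-mine dec _ dominator ≤-refl)

-- Playing the two strategies against each other ends in a single full board won by both players.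
not-both : ∀ {W : Outcome n} → Exclusive W → ∀ {τ p} →
           Win W dominator τ p → ¬ Win W staller (flip τ) p
not-both ex {mine}   (over _ w)         (over _ w′)        = ex _ w w′
not-both ex {mine}   (over full _)      (reply (v , fr) _) = full v fr
not-both ex {mine}   (move v fr _)      (over full _)      = full v fr
not-both ex {mine}   (move v fr s)      (reply _ s′)       = not-both ex s (s′ v fr)
not-both ex {theirs} (over _ w)         (over _ w′)        = ex _ w w′
not-both ex {theirs} (over full _)      (move v fr _)      = full v fr
not-both ex {theirs} (reply (v , fr) _) (over full _)      = full v fr
not-both ex {theirs} (reply _ s)        (move v fr s′)     = not-both ex (s v fr) s′

undisputed : ∀ {W : Outcome n} → Exclusive W → ∀ {p} P Q →
             Win W P (turn P Q) p → ¬ Win W (opponent P) (turn (opponent P) Q) p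
undisputed ex dominator dominator w w′ = not-both ex w w′
undisputed ex dominator staller   w w′ = not-both ex w w′
undisputed ex staller   dominator w w′ = not-both ex w′ w
undisputed ex staller   staller   w w′ = not-both ex w′ w

-- Carrying winning strategies from one game to another.

Carries : ∀ {m} → Outcome m → Position m → Outcome n → Position n → Set
Carries V q W p = ∀ P Q → Win V P (turn P Q) q → Win W P (turn P Q) p

-- By determinacy it is enough to carry over the strategies of both players in
-- one direction.
carries-sym : ∀ {m} {V : Outcome m} {W : Outcome n} {q p} → Decided V → Exclusive W →
              Carries V q W p → Carries W p V q
carries-sym dec ex c P Q w with determined dec P Q
... | inj₁ v = v
... | inj₂ v = contradiction (c (opponent P) Q v) (undisputed ex P Q w)

-- P follows, on the board p, a winning strategy for the board q, on which the
-- vertices of T are already claimed, and makes sure of claiming one of them.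
module Simulation
  (n : ℕ) (V W : Outcome n) (mono : Monotone V)
  (T : Fin n → Set) (T? : ∀ x → Dec (T x))
  (q₀ : Position n) (q₀-claimed : ∀ x → T x → ¬ Free q₀ x) (P : Player)
  (transfer : ∀ p q → (∀ x → ¬ T x → lookup p x ≡ lookup q x) →
              (∀ x → T x → lookup q x ≡ lookup q₀ x) →
              ∃[ t ] (T t × Claimed P p t) → V P q → W P p)
  where

  -- The play on `p` is the real one; on the imagined board `q` the moves inside `T` never happen.
  record Follows (p q : Position n) : Set where
    constructor follows
    field
      outside : ∀ x → ¬ T x → lookup p x ≡ lookup q x
      inside  : ∀ x → T x → lookup q x ≡ lookup q₀ x

  -- As long as `P` owns nothing in `T`, two free vertices of `T` are held in reserve, so that a
  -- claim of one by the opponent can be answered at the other.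
  data Ready (p : Position n) : Set where
    secured : ∀ t → T t → Claimed P p t → Ready p
    paired  : ∀ s t → s ≢ t → T s → T t → Free p s → Free p t → Ready p

  T-claimed : ∀ {p q} → Follows p q → ∀ x → T x → ¬ Free q x
  T-claimed (follows _ ins) x Tx fr = q₀-claimed x Tx (trans (sym (ins x Tx)) fr)

  both : ∀ {p q} v {a} → ¬ T v → Follows p q → Follows (p [ v ]≔ a) (q [ v ]≔ a)
  both {p} {q} v {a} ¬Tv (follows out ins) = follows out′ ins′
    where
    out′ : ∀ x → ¬ T x → lookup (p [ v ]≔ a) x ≡ lookup (q [ v ]≔ a) x
    out′ x ¬Tx with x Fin.≟ v
    ... | yes refl = trans (lookup∘update v p a) (sym (lookup∘update v q a))
    ... | no  x≢v  =
      trans (lookup∘update′ x≢v p a) (trans (out x ¬Tx) (sym (lookup∘update′ x≢v q a)))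
    ins′ : ∀ x → T x → lookup (q [ v ]≔ a) x ≡ lookup q₀ x
    ins′ x Tx = trans (lookup∘update′ (λ { refl → ¬Tv Tx }) q a) (ins x Tx)

  own : ∀ {p q} v {a} → T v → Follows p q → Follows (p [ v ]≔ a) q
  own {p} v {a} Tv (follows out ins) =
    follows (λ x ¬Tx → trans (lookup∘update′ (λ { refl → ¬Tx Tv }) p a) (out x ¬Tx)) ins

  still-ready : ∀ {p} v {a} → Free p v → ¬ T v → Ready p → Ready (p [ v ]≔ a)
  still-ready {p} v fr ¬Tv (secured t Tt cl) =
    secured t Tt (trans (lookup∘update′ (λ { refl → ¬Tv Tt }) p _) cl)
  still-ready {p} v fr ¬Tv (paired s t s≢t Ts Tt fs ft) =
    paired s t s≢t Ts Tt
      (trans (lookup∘update′ (λ { refl → ¬Tv Ts }) p _) fs)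
      (trans (lookup∘update′ (λ { refl → ¬Tv Tt }) p _) ft)

  finish : ∀ {p q τ} → Full p → Follows p q → Ready p → V P q → Win W P τ p
  finish full (follows out ins) (secured t Tt cl) won =
    over full (transfer _ _ out ins (t , Tt , cl) won)
  finish full _ (paired s _ _ _ _ fs _) won = contradiction fs (full s)

  full-follows : ∀ {p q} → Full p → Follows p q → Full q
  full-follows {p} {q} full fol@(follows out _) v fr with T? v
  ... | yes Tv = T-claimed fol v Tv fr
  ... | no ¬Tv = full v (trans (out v ¬Tv) fr)

  take : ∀ (p : Position n) v → Claimed P (p [ v ]≔ just P) v
  take p v = lookup∘update v p _

  mutual
    simulate : ∀ k {p q τ} → #free p ≤ k → Follows p q → Ready p →
               Win V P τ q → Win W P τ p
    simulate k {p} le fol ready s with full? p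
    simulate k le fol ready (over _ won) | inj₁ full = finish full fol ready won
    simulate k le fol ready (move v fr _) | inj₁ full =
      contradiction fr (full-follows full fol v)
    simulate k le fol ready (reply (v , fr) _) | inj₁ full =
      contradiction fr (full-follows full fol v)
    simulate zero {p} le fol ready s | inj₂ (v , fr) = contradiction le (claim-≰0 p v fr)
    -- The board `q` is full, so whatever is still free on `p` lies in `T`, and taking it leaves `q`
    -- untouched.
    simulate (suc k) {p} {q} {mine} le fol ready (over full won) | inj₂ (v , fr) with T? v
    ... | yes Tv = move v fr (simulate k (claim-≤ p v fr le) (own v Tv fol)
                                (secured v Tv (take p v)) (over full won))
    ... | no ¬Tv = contradiction (trans (sym (Follows.outside fol v ¬Tv)) fr) (full v)
    simulate (suc k) {p} le fol ready (move v fr s) | inj₂ _ =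
      let ¬Tv = λ Tv → T-claimed fol v Tv fr
          fr′ = trans (Follows.outside fol v ¬Tv) fr
      in move v fr′ (simulate k (claim-≤ p v fr′ le) (both v ¬Tv fol)
                       (still-ready v fr′ ¬Tv ready) s)
    simulate (suc k) {p} {q} {theirs} le fol ready s | inj₂ ∃free = reply ∃free answer
      where
      answer : ∀ v → Free p v → Win W P mine (p [ v ]≔ just (opponent P))
      answer v fr with T? v
      ... | yes Tv = respond k v Tv fr le fol ready s
      ... | no ¬Tv = elsewhere v ¬Tv fr s
        where
        elsewhere : ∀ v → ¬ T v → Free p v → Win V P theirs q →
                    Win W P mine (p [ v ]≔ just (opponent P))
        elsewhere v ¬Tv fr (over full _) =
          contradiction (trans (sym (Follows.outside fol v ¬Tv)) fr) (full v)
        elsewhere v ¬Tv fr (reply _ s′)  =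
          simulate k (claim-≤ p v fr le) (both v ¬Tv fol) (still-ready v fr ¬Tv ready)
            (s′ v (trans (sym (Follows.outside fol v ¬Tv)) fr))

    -- A move inside `T` has no counterpart on `q`, where the opponent is still to move. If `T` is
    -- secured, `tempo` lets `P` move on `q` out of turn; otherwise an answer inside `T` makes it
    -- the opponent's turn on `p` as well.
    respond : ∀ k {p q} v → T v → Free p v → #free p ≤ suc k → Follows p q → Ready p →
              Win V P theirs q → Win W P mine (p [ v ]≔ just (opponent P))
    respond k {p} v Tv fr le fol (secured t Tt cl) s =
      simulate k (claim-≤ p v fr le) (own v Tv fol)
        (secured t Tt (trans (lookup∘update′ (λ { refl → claimed-not-free p cl fr }) p _) cl))
        (tempo mono _ ≤-refl s)
    respond k {p} v Tv fr le fol (paired a b a≢b Ta Tb fa fb) s with a Fin.≟ v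
    ... | yes refl = grab k b Tb (trans (lookup∘update′ (≢-sym a≢b) p _) fb)
                       (claim-≤ p v fr le) (own v Tv fol) s
    ... | no  a≢v  = grab k a Ta (trans (lookup∘update′ a≢v p _) fa)
                       (claim-≤ p v fr le) (own v Tv fol) s

    grab : ∀ k {p q} t → T t → Free p t → #free p ≤ k → Follows p q →
           Win V P theirs q → Win W P mine p
    grab zero {p} t Tt fr le _ _ = contradiction le (claim-≰0 p t fr)
    grab (suc k) {p} t Tt fr le fol s =
      move t fr (simulate k (claim-≤ p t fr le) (own t Tt fol) (secured t Tt (take p t)) s)

-- Deleting a vertex that has two twins

_≟ᴾ_ : (P Q : Player) → Dec (P ≡ Q)
dominator ≟ᴾ dominator = yes refl
dominator ≟ᴾ staller   = no λ ()
staller   ≟ᴾ dominator = no λ ()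
staller   ≟ᴾ staller   = yes refl

claimed? : ∀ P (p : Position n) v → Dec (Claimed P p v)
claimed? P p v = Maybe.≡-dec _≟ᴾ_ (lookup p v) (just P)

Alive : ℕ → Set
Alive n = Fin n → Bool

Dominates : Graph n → Alive n → Position n → Set
Dominates G K p =
  ∀ x → K x ≡ true → Claimed dominator p x ⊎ ∃[ u ] (Claimed dominator p u × u ∈ N G x)

-- Deleting vertices while keeping the board: the deleted ones count as claimed
-- by Staller, and Dominator need not dominate them.
Restricted : Graph n → Alive n → Outcome n
Restricted G K dominator p = Dominates G K p
Restricted G K staller   p = ¬ Dominates G K p

dominates? : ∀ (G : Graph n) K p → Dec (Dominates G K p)
dominates? G K p = Fin.all? λ x → (K x Bool.≟ true) →-dec
  (claimed? dominator p x ⊎-dec Fin.any? λ u → claimed? dominator p u ×-dec (u ∈? N G x))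

restricted-decided : ∀ (G : Graph n) K → Decided (Restricted G K)
restricted-decided G K p with dominates? G K p
... | yes d = inj₁ d
... | no ¬d = inj₂ ¬d

restricted-exclusive : ∀ (G : Graph n) K → Exclusive (Restricted G K)
restricted-exclusive G K p d ¬d = ¬d d

dominates-mono : ∀ (G : Graph n) K {p q} →
                 (∀ x → Claimed dominator p x → Claimed dominator q x) →
                 Dominates G K p → Dominates G K q
dominates-mono G K p⊆q dom x Kx =
  Sum.map (p⊆q x) (λ { (u , cl , adj) → u , p⊆q u cl , adj }) (dom x Kx)

restricted-monotone : ∀ (G : Graph n) K → Monotone (Restricted G K)
restricted-monotone G K P p v = go P
  where
  raise : ∀ x → Claimed dominator (p [ v ]≔ just staller) x →
          Claimed dominator (p [ v ]≔ just dominator) x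
  raise x cl with x Fin.≟ v
  ... | yes refl = lookup∘update v p _
  ... | no  x≢v  =
    trans (lookup∘update′ x≢v p _) (trans (sym (lookup∘update′ x≢v p _)) cl)
  go : ∀ P → Restricted G K P (p [ v ]≔ just (opponent P)) →
       Restricted G K P (p [ v ]≔ just P)
  raised : Dominates G K (p [ v ]≔ just staller) → Dominates G K (p [ v ]≔ just dominator)
  raised = dominates-mono G K {p [ v ]≔ just staller} {p [ v ]≔ just dominator} raise
  go dominator dom = raised dom
  go staller   ¬dom dom = ¬dom (raised dom)

sameType-∈ : ∀ (G : Graph n) {u v x} → SameType G u v → x ≢ u → x ≢ v →
             x ∈ N G u → x ∈ N G v
sameType-∈ G {u} {v} same x≢u x≢v x∈u =
  p─q⊆p (N G v) _ (subst (_ ∈_) same (x∈p∧x≢y⇒x∈p-y x∈u x≢v))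

∈-sameType : ∀ (G : Graph n) {u v x} → SameType G u v → x ≢ u → x ≢ v →
             u ∈ N G x → v ∈ N G x
∈-sameType G same x≢u x≢v u∈x = symmetric G (sameType-∈ G same x≢u x≢v (symmetric G u∈x))

-- The edge between `u` and `y` is carried to any other pair by exchanging its endpoints one at a
-- time for vertices of the same type.
clique : ∀ (G : Graph n) (T : Fin n → Set) →
         (∀ {x y} → T x → T y → SameType G x y) →
         ∀ {u y} → T u → T y → u ∈ N G y →
         ∀ {w x} → T w → T x → w ≢ x → w ∈ N G x
clique G T same {u} {y} Tu Ty u∈y {w} {x} Tw Tx w≢x with x Fin.≟ u
... | yes refl = symmetric G (from-u w Tw w≢x)
  where
  from-u : ∀ z → T z → z ≢ u → u ∈ N G z
  from-u z Tz z≢u =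
    sameType-∈ G (same Ty Tz) (λ { refl → irreflexive G u∈y }) (≢-sym z≢u) u∈y
... | no x≢u with w Fin.≟ u
...   | yes refl = sameType-∈ G (same Ty Tx) (λ { refl → irreflexive G u∈y }) w≢x u∈y
...   | no  w≢u  = symmetric G (sameType-∈ G (same Tu Tw) x≢u (≢-sym w≢x)
    (symmetric G (sameType-∈ G (same Ty Tx) (λ { refl → irreflexive G u∈y }) (≢-sym x≢u) u∈y)))

-- A class of which s leaves a vertex to Staller and t gives one to Dominator
-- is dominated in t from the outside or through the clique it induces.
dominates-transfer :
  ∀ (G : Graph n) {K L} (T : Fin n → Set) → (∀ x → Dec (T x)) →
  (∀ {x y} → T x → T y → SameType G x y) →
  ∀ {s t : Position n} → (∀ x → ¬ T x → lookup s x ≡ lookup t x) →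
  (∀ x → ¬ T x → L x ≡ true → K x ≡ true) →
  ∀ y → T y → K y ≡ true → Claimed staller s y →
  ∀ w → T w → Claimed dominator t w →
  Dominates G K s → Dominates G L t
dominates-transfer G {K} {L} T T? same {s} {t} agree L⊆K y Ty Ky y-lost w Tw w-won dom x Lx
  with T? x
dominates-transfer G T T? same {s} {t} agree L⊆K y Ty Ky y-lost w Tw w-won dom x Lx
  | no ¬Tx with dom x (L⊆K x ¬Tx Lx)
... | inj₁ cl = inj₁ (trans (sym (agree x ¬Tx)) cl)
... | inj₂ (u , cl , u∈x) with T? u
...   | no ¬Tu = inj₂ (u , trans (sym (agree u ¬Tu)) cl , u∈x)
-- A vertex outside `T` is adjacent to all of `T` or to none of it, so `w` replaces `u`.
...   | yes Tu = inj₂ (w , w-won ,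
          ∈-sameType G (same Tu Tw) (λ { refl → ¬Tx Tu }) (λ { refl → ¬Tx Tw }) u∈x)
-- `y` is Staller's in `s`, so Dominator owns a neighbor `u` of it. If `u` is outside `T`, it is
-- adjacent to `x` too; if inside, `T` is a clique and `w` equals or dominates `x`.
dominates-transfer G T T? same {s} {t} agree L⊆K y Ty Ky y-lost w Tw w-won dom x Lx
  | yes Tx with dom y Ky
... | inj₁ cl with () ← trans (sym y-lost) cl
... | inj₂ (u , cl , u∈y) with T? u
...   | no ¬Tu = inj₂ (u , trans (sym (agree u ¬Tu)) cl ,
          sameType-∈ G (same Ty Tx) (λ { refl → ¬Tu Ty }) (λ { refl → ¬Tu Tx }) u∈y)
...   | yes Tu with w Fin.≟ x
...     | yes refl = inj₁ w-won
...     | no  w≢x  = inj₂ (w , w-won , clique G T same Tu Ty u∈y Tw Tx w≢x)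

owner : Bool → Maybe Player
owner true  = nothing
owner false = just staller

start : Alive n → Position n
start K = tabulate λ x → owner (K x)

lookup-start : ∀ (K : Alive n) x → lookup (start K) x ≡ owner (K x)
lookup-start K = lookup∘tabulate _

start-free : ∀ (K : Alive n) x → K x ≡ true → Free (start K) x
start-free K x Kx = trans (lookup-start K x) (cong owner Kx)

start-claimed : ∀ (K : Alive n) x → K x ≡ false → Claimed staller (start K) x
start-claimed K x Kx = trans (lookup-start K x) (cong owner Kx)

split : Alive n → Fin n → Fin n → Position n
split K a b = (start K [ a ]≔ just dominator) [ b ]≔ just staller

-- `K` governs the game in which `T` is already split between the players, `L` the one in which all
-- of `T` is free. Keeping them apart allows `T` to be the two surviving twins, or these together
-- with the deleted vertex, while the split position stays the same.
module Splitting
  (n : ℕ) (G : Graph n) (K L : Alive n) (T : Fin n → Set) (T? : ∀ x → Dec (T x))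
  (same : ∀ {x y} → T x → T y → SameType G x y)
  (T⊆L : ∀ x → T x → L x ≡ true) (K≡L : ∀ x → ¬ T x → K x ≡ L x)
  (a b : Fin n) (a≢b : a ≢ b) (Ta : T a) (Tb : T b) (Kb : K b ≡ true)
  (rest : ∀ x → T x → x ≢ a → x ≢ b → K x ≡ false)
  where

  q₀ : Position n
  q₀ = split K a b

  q₀-a : Claimed dominator q₀ a
  q₀-a = trans (lookup∘update′ a≢b (start K [ a ]≔ _) _) (lookup∘update a (start K) _)

  q₀-b : Claimed staller q₀ b
  q₀-b = lookup∘update b (start K [ a ]≔ _) _

  q₀-else : ∀ x → x ≢ a → x ≢ b → lookup q₀ x ≡ lookup (start K) x
  q₀-else x x≢a x≢b = trans (lookup∘update′ x≢b (start K [ a ]≔ _) _) (lookup∘update′ x≢a (start K) _)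

  q₀-claimed : ∀ x → T x → ¬ Free q₀ x
  q₀-claimed x Tx with x Fin.≟ a
  ... | yes refl = claimed-not-free q₀ q₀-a
  ... | no x≢a with x Fin.≟ b
  ...   | yes refl = claimed-not-free q₀ q₀-b
  ...   | no  x≢b  = claimed-not-free q₀
            (trans (q₀-else x x≢a x≢b) (start-claimed K x (rest x Tx x≢a x≢b)))

  transfer : ∀ P p q → (∀ x → ¬ T x → lookup p x ≡ lookup q x) →
             (∀ x → T x → lookup q x ≡ lookup q₀ x) →
             ∃[ t ] (T t × Claimed P p t) → Restricted G K P q → Restricted G L P p
  -- For Dominator, domination passes from `q`, where `b` is lost, to `p`, where `t` is won. For
  -- Staller the contrapositive is used: domination would pass from `p`, where `t` is lost, to `q`,
  -- where `a` is won.
  transfer dominator p q out ins (t , Tt , cl) =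
    dominates-transfer G T T? same {q} {p} (λ x ¬Tx → sym (out x ¬Tx))
      (λ x ¬Tx → trans (K≡L x ¬Tx)) b Tb Kb (trans (ins b Tb) q₀-b) t Tt cl
  transfer staller p q out ins (t , Tt , cl) ¬dom dom = ¬dom
    (dominates-transfer G T T? same {p} {q} out
      (λ x ¬Tx → trans (sym (K≡L x ¬Tx))) t Tt (T⊆L t Tt) cl a Ta (trans (ins a Ta) q₀-a) dom)

  unsplit : Carries (Restricted G K) q₀ (Restricted G L) (start L)
  unsplit P Q = simulate _ ≤-refl
    (follows
      (λ x ¬Tx → trans (lookup-start L x)
        (trans (sym (trans (lookup-start K x)
                      (cong owner (K≡L x ¬Tx))))
          (sym (q₀-else x (λ { refl → ¬Tx Ta }) (λ { refl → ¬Tx Tb })))))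
      (λ _ _ → refl))
    (paired a b a≢b Ta Tb (start-free L a (T⊆L a Ta)) (start-free L b (T⊆L b Tb)))
    where
    open Simulation n (Restricted G K) (Restricted G L) (restricted-monotone G K)
      T T? q₀ q₀-claimed P (transfer P)

carries-trans : ∀ {l m} {U : Outcome l} {V : Outcome m} {W : Outcome n} {r q p} →
                Carries U r V q → Carries V q W p → Carries U r W p
carries-trans f g P Q = g P Q ∘ f P Q

record Twins (G : Graph n) (K : Alive n) (v a b : Fin n) : Set where
  field
    v≢a : v ≢ a
    v≢b : v ≢ b
    a≢b : a ≢ b
    Kv  : K v ≡ true
    Ka  : K a ≡ true
    Kb  : K b ≡ true
    v~a : SameType G v a
    v~b : SameType G v b
    a~b : SameType G a b

delete : Alive n → Fin n → Alive n
delete K v x with x Fin.≟ v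
... | yes _ = false
... | no  _ = K x

delete-same : ∀ (K : Alive n) v → delete K v v ≡ false
delete-same K v with v Fin.≟ v
... | yes _  = refl
... | no v≢v = contradiction refl v≢v

delete-other : ∀ (K : Alive n) v x → x ≢ v → delete K v x ≡ K x
delete-other K v x x≢v with x Fin.≟ v
... | yes x≡v = contradiction x≡v x≢v
... | no  _   = refl

-- Both games are won by the winner of the game in which the deleted vertex is
-- absent, a is already claimed by Dominator and b by Staller.
delete-twin : ∀ (G : Graph n) K v a b → Twins G K v a b →
              Carries (Restricted G (delete K v)) (start (delete K v)) (Restricted G K) (start K)
delete-twin {n} G K v a b tw = carries-trans
  (carries-sym (restricted-decided G K′) (restricted-exclusive G K′) Two.unsplit)
  Three.unsplit
  where
  open Twins tw
  K′ = delete K v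
  K′a = trans (delete-other K v a (≢-sym v≢a)) Ka
  K′b = trans (delete-other K v b (≢-sym v≢b)) Kb

  Pair : Fin n → Set
  Pair x = x ≡ a ⊎ x ≡ b

  pair? : ∀ x → Dec (Pair x)
  pair? x = (x Fin.≟ a) ⊎-dec (x Fin.≟ b)

  pair-same : ∀ {x y} → Pair x → Pair y → SameType G x y
  pair-same (inj₁ refl) (inj₁ refl) = refl
  pair-same (inj₁ refl) (inj₂ refl) = a~b
  pair-same (inj₂ refl) (inj₁ refl) = sym a~b
  pair-same (inj₂ refl) (inj₂ refl) = refl

  Triple : Fin n → Set
  Triple x = x ≡ v ⊎ Pair x

  triple-same : ∀ {x y} → Triple x → Triple y → SameType G x y
  triple-same (inj₁ refl)        (inj₁ refl)        = refl
  triple-same (inj₁ refl)        (inj₂ (inj₁ refl)) = v~a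
  triple-same (inj₁ refl)        (inj₂ (inj₂ refl)) = v~b
  triple-same (inj₂ (inj₁ refl)) (inj₁ refl)        = sym v~a
  triple-same (inj₂ (inj₂ refl)) (inj₁ refl)        = sym v~b
  triple-same (inj₂ x)           (inj₂ y)           = pair-same x y

  pair-alive : ∀ x → Pair x → K′ x ≡ true
  pair-alive _ (inj₁ refl) = K′a
  pair-alive _ (inj₂ refl) = K′b

  pair-rest : ∀ x → Pair x → x ≢ a → x ≢ b → K′ x ≡ false
  pair-rest _ (inj₁ refl) x≢a _ = contradiction refl x≢a
  pair-rest _ (inj₂ refl) _ x≢b = contradiction refl x≢b

  triple-alive : ∀ x → Triple x → K x ≡ true
  triple-alive _ (inj₁ refl)        = Kv
  triple-alive _ (inj₂ (inj₁ refl)) = Ka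
  triple-alive _ (inj₂ (inj₂ refl)) = Kb

  triple-rest : ∀ x → Triple x → x ≢ a → x ≢ b → K′ x ≡ false
  triple-rest _ (inj₁ refl) _   _   = delete-same K v
  triple-rest x (inj₂ px)   x≢a x≢b = pair-rest x px x≢a x≢b

  module Two = Splitting n G K′ K′ Pair pair? pair-same pair-alive (λ _ _ → refl)
    a b a≢b (inj₁ refl) (inj₂ refl) K′b pair-rest

  module Three = Splitting n G K′ K Triple (λ x → (x Fin.≟ v) ⊎-dec pair? x) triple-same
    triple-alive (λ x ¬Tx → delete-other K v x (¬Tx ∘ inj₁))
    a b a≢b (inj₂ (inj₁ refl)) (inj₂ (inj₂ refl)) K′b triple-rest

-- The game on an induced subgraph.

module Embedding
  (m n : ℕ) (H : Graph m) (G : Graph n) (K : Alive n) (e : Fin m → Fin n)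
  (e-injective : ∀ {x y} → e x ≡ e y → x ≡ y)
  (K-e : ∀ x → K (e x) ≡ true) (e-surjective : ∀ y → K y ≡ true → ∃[ x ] e x ≡ y)
  (adjacent⇒ : ∀ {x y} → x ∈ N H y → e x ∈ N G (e y))
  (adjacent⇐ : ∀ {x y} → e x ∈ N G (e y) → x ∈ N H y)
  where

  record Mirrors (p : Position n) (q : Position m) : Set where
    constructor mirrors
    field
      alive   : ∀ x → lookup p (e x) ≡ lookup q x
      deleted : ∀ y → K y ≡ false → Claimed staller p y

  mirror-claim : ∀ {p q} v {a} → Mirrors p q → Mirrors (p [ e v ]≔ a) (q [ v ]≔ a)
  mirror-claim {p} {q} v {a} (mirrors al del) = mirrors al′ del′
    where
    al′ : ∀ x → lookup (p [ e v ]≔ a) (e x) ≡ lookup (q [ v ]≔ a) x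
    al′ x with x Fin.≟ v
    ... | yes refl = trans (lookup∘update (e v) p a) (sym (lookup∘update v q a))
    ... | no  x≢v  = trans (lookup∘update′ (x≢v ∘ e-injective) p a)
                       (trans (al x) (sym (lookup∘update′ x≢v q a)))
    del′ : ∀ y → K y ≡ false → Claimed staller (p [ e v ]≔ a) y
    del′ y ¬Ky = trans
      (lookup∘update′ (λ { refl → contradiction (trans (sym (K-e v)) ¬Ky) λ () }) p a) (del y ¬Ky)

  free-alive : ∀ {p q} → Mirrors p q → ∀ y → Free p y → ∃[ x ] (e x ≡ y × Free q x)
  free-alive {p} (mirrors al del) y fr with K y in Ky
  ... | false = contradiction fr (claimed-not-free p (del y Ky))
  ... | true with x , refl ← e-surjective y Ky = x , refl , trans (sym (al x)) fr

  -- `DominatorDominates` asks for some set within Dominator's claims; the set of all her claims is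
  -- the best candidate.
  claimed-set : Position m → Subset m
  claimed-set q = tabulate λ v → does (claimed? dominator q v)

  dominates⇒ : ∀ {p q} → Mirrors p q → DominatorDominates H q → Dominates G K p
  dominates⇒ (mirrors al _) (D , D-claimed , D-dom) y Ky with x , refl ← e-surjective y Ky | D-dom x
  ... | inj₁ x∈D             = inj₁ (trans (al x) (D-claimed x∈D))
  ... | inj₂ (u , u∈D , adj) = inj₂ (e u , trans (al u) (D-claimed u∈D) , adjacent⇒ adj)

  dominates⇐ : ∀ {p q} → Mirrors p q → Dominates G K p → DominatorDominates H q
  dominates⇐ {p} {q} (mirrors al del) dom = claimed-set q , sound , λ x → covers x (dom (e x) (K-e x))
    where
    complete : ∀ v → Claimed dominator q v → v ∈ claimed-set q
    complete v cl = lookup⇒[]= v _ (trans (lookup∘tabulate _ v) go)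
      where
      go : does (claimed? dominator q v) ≡ true
      go with claimed? dominator q v
      ... | yes _  = refl
      ... | no ¬cl = contradiction cl ¬cl
    sound : ∀ {v} → v ∈ claimed-set q → Claimed dominator q v
    sound {v} v∈ with claimed? dominator q v | trans (sym (lookup∘tabulate _ v)) ([]=⇒lookup v∈)
    ... | yes cl | _ = cl
    ... | no  _  | ()
    covers : ∀ x → Claimed dominator p (e x) ⊎ ∃[ u ] (Claimed dominator p u × u ∈ N G (e x)) →
             x ∈ claimed-set q ⊎ ∃[ u ] (u ∈ claimed-set q × u ∈ N H x)
    covers x (inj₁ cl) = inj₁ (complete x (trans (sym (al x)) cl))
    covers x (inj₂ (u , cl , adj)) with K u in Ku
    -- Deleted vertices count as Staller's, so Dominator's neighbor `u` is never one of them.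
    ... | false with () ← trans (sym (del u Ku)) cl
    ... | true with v , refl ← e-surjective u Ku =
      inj₂ (v , complete v (trans (sym (al v)) cl) , adjacent⇐ adj)

  won⇒ : ∀ P {p q} → Mirrors p q → WonBy H P q → Restricted G K P p
  won⇒ dominator mir d = dominates⇒ mir d
  won⇒ staller   mir ¬d d = ¬d (dominates⇐ mir d)

  lift : ∀ {P τ p q} → Mirrors p q → Win (WonBy H) P τ q → Win (Restricted G K) P τ p
  lift mir (over full won) =
    over (λ y fr → let x , _ , fx = free-alive mir y fr in full x fx) (won⇒ _ mir won)
  lift mir (move v fr s) =
    move (e v) (trans (Mirrors.alive mir v) fr) (lift (mirror-claim v mir) s)
  lift {P} {p = p} mir (reply (v , fr) s) =
    reply (e v , trans (Mirrors.alive mir v) fr) answer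
    where
    answer : ∀ y → Free p y → Win _ P mine (p [ y ]≔ just (opponent P))
    answer y fy with x , refl , fx ← free-alive mir y fy = lift (mirror-claim x mir) (s x fx)

  -- Links the two ways of deleting vertices: shrinking the board, and handing the vertices to
  -- Staller on the old board. Free vertices correspond, so strategies translate move by move.
  embed-carries : Carries (WonBy H) (replicate m nothing) (Restricted G K) (start K)
  embed-carries P Q = lift (mirrors
    (λ x → trans (start-free K (e x) (K-e x)) (sym (lookup-replicate x nothing)))
    (start-claimed K))

everything : Alive n
everything _ = true

-- With nothing deleted, the embedding compares `WonBy`, stated with a chosen dominating set, with
-- `Restricted`, stated with all of Dominator's claims and decidable.
module Identity (n : ℕ) (G : Graph n) =
  Embedding n n G G everything id id (λ _ → refl) (λ y _ → y , refl) id id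

wonBy-exclusive : ∀ (G : Graph n) → Exclusive (WonBy G)
wonBy-exclusive G p d ¬d = ¬d d

mirrors-self : ∀ n (G : Graph n) p → Identity.Mirrors n G p p
mirrors-self n G p = Identity.mirrors (λ _ → refl) (λ _ ())

wonBy-decided : ∀ (G : Graph n) → Decided (WonBy G)
wonBy-decided {n} G p with dominates? G everything p
... | yes d = inj₁ (Identity.dominates⇐ n G (mirrors-self n G p) d)
... | no ¬d = inj₂ (¬d ∘ Identity.dominates⇒ n G (mirrors-self n G p))

embed : (S : Subset n) → Fin ∣ S ∣ → Fin n
embed (true  ∷ S) zero    = zero
embed (true  ∷ S) (suc x) = suc (embed S x)
embed (false ∷ S) x       = suc (embed S x)

embed-injective : ∀ (S : Subset n) {x y} → embed S x ≡ embed S y → x ≡ y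
embed-injective (true  ∷ S) {zero}  {zero}  _  = refl
embed-injective (true  ∷ S) {suc x} {suc y} eq = cong suc (embed-injective S (Fin.suc-injective eq))
embed-injective (false ∷ S)                 eq = embed-injective S (Fin.suc-injective eq)

lookup-embed : ∀ (S : Subset n) x → lookup S (embed S x) ≡ true
lookup-embed (true  ∷ S) zero    = refl
lookup-embed (true  ∷ S) (suc x) = lookup-embed S x
lookup-embed (false ∷ S) x       = lookup-embed S x

embed-surjective : ∀ (S : Subset n) y → lookup S y ≡ true → ∃[ x ] embed S x ≡ y
embed-surjective (true  ∷ S) zero    _  = zero , refl
embed-surjective (true  ∷ S) (suc y) Sy with x , eq ← embed-surjective S y Sy = suc x , cong suc eq
embed-surjective (false ∷ S) (suc y) Sy with x , eq ← embed-surjective S y Sy = x , cong suc eq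

inducedN : Graph n → (S : Subset n) → Fin ∣ S ∣ → Subset ∣ S ∣
inducedN G S x = tabulate λ y → lookup (N G (embed S x)) (embed S y)

∈-inducedN⁻ : ∀ (G : Graph n) S {x y} → x ∈ inducedN G S y → embed S x ∈ N G (embed S y)
∈-inducedN⁻ G S {x} x∈y = lookup⇒[]= _ _ (trans (sym (lookup∘tabulate _ x)) ([]=⇒lookup x∈y))

∈-inducedN⁺ : ∀ (G : Graph n) S {x y} → embed S x ∈ N G (embed S y) → x ∈ inducedN G S y
∈-inducedN⁺ G S {x} x∈y = lookup⇒[]= _ _ (trans (lookup∘tabulate _ x) ([]=⇒lookup x∈y))

induced : Graph n → (S : Subset n) → Graph ∣ S ∣
induced G S = record
  { N           = inducedN G S
  ; symmetric   = λ u∈v → ∈-inducedN⁺ G S (symmetric G (∈-inducedN⁻ G S u∈v))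
  ; irreflexive = irreflexive G ∘ ∈-inducedN⁻ G S
  }

-- Deleting all vertices with two later twins.

record LaterTwins (G : Graph n) (v : Fin n) : Set where
  field
    a b : Fin n
    v<a : v Fin.< a
    a<b : a Fin.< b
    v~a : SameType G v a
    v~b : SameType G v b
    a~b : SameType G a b

-- `pending` guarantees that the later twins are alive when needed; at `j = n` the fields `kept` and
-- `deleted` identify `K` with `S`.
record DeletedBelow (G : Graph n) (S : Subset n) (j : ℕ) : Set where
  field
    K       : Alive n
    kept    : ∀ x → lookup S x ≡ true → K x ≡ true
    pending : ∀ x → j ≤ toℕ x → K x ≡ true
    deleted : ∀ x → toℕ x < j → lookup S x ≡ false → K x ≡ false
    carries : Carries (Restricted G K) (start K) (Restricted G everything) (start everything)

module Deletion
  (n : ℕ) (G : Graph n) (S : Subset n) (twins : ∀ v → lookup S v ≡ false → LaterTwins G v)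
  where

  -- Vertices are deleted in increasing order, so that the later twins of a
  -- vertex are still present when it is deleted.
  delete-below : ∀ j → j ≤ n → DeletedBelow G S j
  delete-below zero _ = record
    { K = everything ; kept = λ _ _ → refl ; pending = λ _ _ → refl
    ; deleted = λ _ () ; carries = λ _ _ w → w }
  delete-below (suc j) j<n = step
    where
    before = delete-below j (<⇒≤ j<n)
    open DeletedBelow before
    v = fromℕ< j<n
    toℕ-v : toℕ v ≡ j
    toℕ-v = Fin.toℕ-fromℕ< j<n
    below : ∀ x → x ≢ v → toℕ x < suc j → toℕ x < j
    below x x≢v (s≤s x≤j) with m≤n⇒m<n∨m≡n x≤j
    ... | inj₁ x<j = x<j
    ... | inj₂ x≡j = contradiction (Fin.toℕ-injective (trans x≡j (sym toℕ-v))) x≢v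
    step : DeletedBelow G S (suc j)
    step with lookup S v in Sv
    ... | true = record
      { K = K ; kept = kept ; pending = λ x j<x → pending x (<⇒≤ j<x)
      ; deleted = λ x x<1+j ¬Sx → deleted x
          (below x (λ { refl → contradiction (trans (sym Sv) ¬Sx) λ () }) x<1+j) ¬Sx
      ; carries = carries }
    ... | false = record
      { K = delete K v
      ; kept = λ x Sx → trans
          (delete-other K v x λ { refl → contradiction (trans (sym Sv) Sx) λ () }) (kept x Sx)
      ; pending = λ x j<x → trans
          (delete-other K v x λ { refl → <-irrefl (sym toℕ-v) j<x }) (pending x (<⇒≤ j<x))
      ; deleted = deleted′
      ; carries = carries-trans (delete-twin G K v a b record
          { v≢a = Fin.<⇒≢ v<a ; v≢b = Fin.<⇒≢ v<b ; a≢b = Fin.<⇒≢ a<b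
          ; Kv = pending v (≤-reflexive (sym toℕ-v))
          ; Ka = pending a (later v<a)
          ; Kb = pending b (later v<b)
          ; v~a = v~a ; v~b = v~b ; a~b = a~b }) carries }
      where
      open LaterTwins (twins v Sv)
      v<b : v Fin.< b
      v<b = Fin.<-trans v<a a<b
      later : ∀ {x} → v Fin.< x → j ≤ toℕ x
      later v<x = ≤-trans (≤-reflexive (sym toℕ-v)) (<⇒≤ v<x)
      deleted′ : ∀ x → toℕ x < suc j → lookup S x ≡ false → delete K v x ≡ false
      deleted′ x x<1+j ¬Sx with x Fin.≟ v
      ... | yes _  = refl
      ... | no x≢v = deleted x (below x x≢v x<1+j) ¬Sx

  private
    all-deleted = delete-below n ≤-refl
    open DeletedBelow all-deleted

    alive-kept : ∀ y → K y ≡ true → lookup S y ≡ true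
    alive-kept y Ky with lookup S y in Sy
    ... | true  = refl
    ... | false with () ← trans (sym Ky) (deleted y (Fin.toℕ<n y) Sy)

    module Ind = Embedding ∣ S ∣ n (induced G S) G K (embed S) (embed-injective S)
      (λ x → kept (embed S x) (lookup-embed S x)) (λ y Ky → embed-surjective S y (alive-kept y Ky))
      (∈-inducedN⁻ G S) (∈-inducedN⁺ G S)

  -- The chain leads from the small board to the board of `G` with deleted vertices, then to the one
  -- with none deleted, and finally to `WonBy G` by reversing the identity embedding.
  induced⇒ : Carries (WonBy (induced G S)) (replicate ∣ S ∣ nothing) (WonBy G) (replicate n nothing)
  induced⇒ = carries-trans Ind.embed-carries (carries-trans carries
    (carries-sym (wonBy-decided G) (restricted-exclusive G everything) (Identity.embed-carries n G)))

  induced⇐ : Carries (WonBy G) (replicate n nothing) (WonBy (induced G S)) (replicate ∣ S ∣ nothing)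
  induced⇐ = carries-sym (wonBy-decided (induced G S)) (wonBy-exclusive G) induced⇒

  sameWinner : ∀ Q → SameWinner record { order = n ; graph = G ; first = Q }
                                record { order = ∣ S ∣ ; graph = induced G S ; first = Q }
  sameWinner Q P = mk⇔ (toStrategy Q ∘ induced⇐ P Q ∘ fromStrategy)
                       (toStrategy Q ∘ induced⇒ P Q ∘ fromStrategy)

-- Polynomial-time functions on trees

-- Polynomials are kept as syntax closed under composition, so that the bound of a composed program
-- is written down directly; the form `a * n ^ d` is extracted only once, at the end.
data Poly : Set where
  const       : ℕ → Poly
  X           : Poly
  _⊕_ _⊗_ _⊚_ : Poly → Poly → Poly

infixr 6 _⊕_
infixr 7 _⊗_
infixr 8 _⊚_

⟦_⟧ : Poly → ℕ → ℕ
⟦ const c ⟧ n = c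
⟦ X ⟧       n = n
⟦ p ⊕ q ⟧   n = ⟦ p ⟧ n + ⟦ q ⟧ n
⟦ p ⊗ q ⟧   n = ⟦ p ⟧ n * ⟦ q ⟧ n
⟦ p ⊚ q ⟧   n = ⟦ p ⟧ (⟦ q ⟧ n)

⟦⟧-mono : ∀ p {m n} → m ≤ n → ⟦ p ⟧ m ≤ ⟦ p ⟧ n
⟦⟧-mono (const c) le = ≤-refl
⟦⟧-mono X         le = le
⟦⟧-mono (p ⊕ q)   le = +-mono-≤ (⟦⟧-mono p le) (⟦⟧-mono q le)
⟦⟧-mono (p ⊗ q)   le = *-mono-≤ (⟦⟧-mono p le) (⟦⟧-mono q le)
⟦⟧-mono (p ⊚ q)   le = ⟦⟧-mono p (⟦⟧-mono q le)

^-distribʳ-* : ∀ d m n → (m * n) ^ d ≡ m ^ d * n ^ d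
^-distribʳ-* zero    m n = refl
^-distribʳ-* (suc d) m n =
  trans (cong (m * n *_) (^-distribʳ-* d m n)) ([m*n]*[o*p]≡[m*o]*[n*p] m n (m ^ d) (n ^ d))

-- The argument is positive because at 0 a monomial of positive degree vanishes and cannot absorb a
-- constant. Tree sizes are always positive.
⟦⟧-bounded : ∀ p → ∃[ a ] ∃[ d ] (∀ n → ⟦ p ⟧ (suc n) ≤ a * suc n ^ d)
⟦⟧-bounded (const c) = c , 0 , λ n → ≤-reflexive (sym (*-identityʳ c))
⟦⟧-bounded X = 1 , 1 , λ n → ≤-reflexive (sym (trans (*-identityˡ _) (*-identityʳ (suc n))))
⟦⟧-bounded (p ⊕ q) with a , d , p≤ ← ⟦⟧-bounded p | b , e , q≤ ← ⟦⟧-bounded q =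
  a + b , d + e , λ n → ≤-trans
    (+-mono-≤ (≤-trans (p≤ n) (*-monoʳ-≤ a (^-monoʳ-≤ (suc n) (m≤m+n d e))))
              (≤-trans (q≤ n) (*-monoʳ-≤ b (^-monoʳ-≤ (suc n) (m≤n+m e d)))))
    (≤-reflexive (sym (*-distribʳ-+ (suc n ^ (d + e)) a b)))
⟦⟧-bounded (p ⊗ q) with a , d , p≤ ← ⟦⟧-bounded p | b , e , q≤ ← ⟦⟧-bounded q =
  a * b , d + e , λ n → ≤-trans (*-mono-≤ (p≤ n) (q≤ n))
    (≤-reflexive (trans ([m*n]*[o*p]≡[m*o]*[n*p] a (suc n ^ d) b (suc n ^ e))
      (cong (a * b *_) (sym (^-distribˡ-+-* (suc n) d e)))))
⟦⟧-bounded (p ⊚ q) with a , d , p≤ ← ⟦⟧-bounded p | b , e , q≤ ← ⟦⟧-bounded q =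
  -- `b` may be 0; with `suc b` the argument of `p` is at least 1, as the bound for `p` demands.
  a * suc b ^ d , e * d , λ n → begin
    ⟦ p ⟧ (⟦ q ⟧ (suc n))            ≤⟨ ⟦⟧-mono p (≤-trans (q≤ n) (*-monoˡ-≤ (suc n ^ e) (n≤1+n b))) ⟩
    ⟦ p ⟧ (suc b * suc n ^ e)        ≤⟨ positive (suc b * suc n ^ e)
                                          (*-mono-≤ (s≤s (z≤n {b})) (m^n>0 (suc n) e)) ⟩
    a * (suc b * suc n ^ e) ^ d      ≡⟨ cong (a *_) (^-distribʳ-* d (suc b) (suc n ^ e)) ⟩
    a * (suc b ^ d * (suc n ^ e) ^ d) ≡⟨ cong (λ m → a * (suc b ^ d * m)) (^-*-assoc (suc n) e d) ⟩
    a * (suc b ^ d * suc n ^ (e * d)) ≡⟨ *-assoc a (suc b ^ d) _ ⟨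
    a * suc b ^ d * suc n ^ (e * d)  ∎
  where
  open ≤-Reasoning
  positive : ∀ m → 1 ≤ m → ⟦ p ⟧ m ≤ a * m ^ d
  positive (suc m) _ = p≤ m

1≤size : ∀ t → 1 ≤ size t
1≤size nil        = s≤s z≤n
1≤size (cons _ _) = s≤s z≤n

size-head : ∀ t → size (head t) ≤ size t
size-head nil        = ≤-refl
size-head (cons s t) = ≤-trans (m≤m+n (size s) (size t)) (n≤1+n _)

size-tail : ∀ t → size (tail t) ≤ size t
size-tail nil        = ≤-refl
size-tail (cons s t) = ≤-trans (m≤n+m (size t) (size s)) (n≤1+n _)

-- The extra one is for `nil`, whose head and tail are both `nil`.
size-head-tail : ∀ t → size (head t) + size (tail t) ≤ suc (size t)
size-head-tail nil        = ≤-refl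
size-head-tail (cons s t) = ≤-trans (n≤1+n _) (n≤1+n _)

-- Programs acting on a stack.

record Exec (C : Command 1) (x y : Tree) (b : ℕ) : Set where
  constructor exec
  field
    {steps} : ℕ
    run     : Run C (x ∷ []) steps (y ∷ [])
    within  : steps ≤ b

weaken : ∀ {C x y b c} → b ≤ c → Exec C x y b → Exec C x y c
weaken b≤c (exec run t≤b) = exec run (≤-trans t≤b b≤c)

x₀ : Fin 1
x₀ = zero

v₀ : Expr 1
v₀ = var zero

exec-assign : ∀ e x → Exec (x₀ ≔ e) x (eval e (x ∷ [])) (suc (cost e))
exec-assign e x = exec assign ≤-refl

tick : Expr 1 → Poly
tick e = const (suc (cost e))

infixr 5 _⨟_
_⨟_ : ∀ {C D x y z b c} → Exec C x y b → Exec D y z c → Exec (C ⨾ D) x z (b + c)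
exec r r≤ ⨟ exec s s≤ = exec (seq r s) (+-mono-≤ r≤ s≤)

-- The code works above any stack `s`, within a time depending on `x` alone, so other values can
-- wait below. `space` is what makes the time of a composition computable from its parts.
record PolyTime (f : Tree → Tree) : Set where
  field
    code  : Command 1
    time  : Poly
    space : Poly
    runs  : ∀ x s → Exec code (cons x s) (cons (f x) s) (⟦ time ⟧ (size x))
    fits  : ∀ x → size (f x) ≤ ⟦ space ⟧ (size x)

open PolyTime

ext : (∀ x → f x ≡ g x) → PolyTime f → PolyTime g
ext f≡g F = record
  { code = code F ; time = time F ; space = space F
  ; runs = λ x s → subst (λ y → Exec (code F) (cons x s) (cons y s) _) (f≡g x) (runs F x s)
  ; fits = λ x → subst (λ y → size y ≤ _) (f≡g x) (fits F x) }

onTop : Expr 1 → Expr 1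
onTop (var x)    = hd (var x)
onTop nil        = nil
onTop (cons e f) = cons (onTop e) (onTop f)
onTop (hd e)     = hd (onTop e)
onTop (tl e)     = tl (onTop e)

eval-onTop : ∀ e x s → eval (onTop e) (cons x s ∷ []) ≡ eval e (x ∷ [])
eval-onTop (var zero) x s = refl
eval-onTop nil        x s = refl
eval-onTop (cons e f) x s = cong₂ cons (eval-onTop e x s) (eval-onTop f x s)
eval-onTop (hd e)     x s = cong head (eval-onTop e x s)
eval-onTop (tl e)     x s = cong tail (eval-onTop e x s)

exprSpace : Expr 1 → Poly
exprSpace (var _)    = X
exprSpace nil        = const 1
exprSpace (cons e f) = const 1 ⊕ exprSpace e ⊕ exprSpace f
exprSpace (hd e)     = exprSpace e
exprSpace (tl e)     = exprSpace e

expr-fits : ∀ e x → size (eval e (x ∷ [])) ≤ ⟦ exprSpace e ⟧ (size x)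
expr-fits (var zero) x = ≤-refl
expr-fits nil        x = ≤-refl
expr-fits (cons e f) x = s≤s (+-mono-≤ (expr-fits e x) (expr-fits f x))
expr-fits (hd e)     x = ≤-trans (size-head (eval e (x ∷ []))) (expr-fits e x)
expr-fits (tl e)     x = ≤-trans (size-tail (eval e (x ∷ []))) (expr-fits e x)

expr : ∀ e → PolyTime (λ x → eval e (x ∷ []))
expr e = record
  { code = x₀ ≔ cons (onTop e) (tl v₀)
  ; time = tick (cons (onTop e) (tl v₀)) ; space = exprSpace e
  ; runs = λ x s → subst (λ y → Exec _ (cons x s) (cons y s) _) (eval-onTop e x s)
                     (exec-assign (cons (onTop e) (tl v₀)) (cons x s))
  ; fits = expr-fits e }

infixr 9 _∘ₚ_
_∘ₚ_ : PolyTime g → PolyTime f → PolyTime (λ x → g (f x))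
G ∘ₚ F = record
  { code = code F ⨾ code G
  ; time = time F ⊕ time G ⊚ space F ; space = space G ⊚ space F
  ; runs = λ x s → runs F x s ⨟ weaken (⟦⟧-mono (time G) (fits F x)) (runs G _ s)
  ; fits = λ x → ≤-trans (fits G _) (⟦⟧-mono (space G) (fits F x)) }

private
  dup swap gather : Expr 1
  dup    = cons (hd v₀) v₀
  swap   = cons (hd (tl v₀)) (cons (hd v₀) (tl (tl v₀)))
  gather = cons (cons (hd (tl v₀)) (hd v₀)) (tl (tl v₀))

-- Each code consumes its argument, hence the duplicate; `swap` lifts the second copy above the
-- first result.
⟨_,_⟩ : PolyTime f → PolyTime g → PolyTime (λ x → cons (f x) (g x))
⟨ F , G ⟩ = record
  { code  = x₀ ≔ dup ⨾ code F ⨾ x₀ ≔ swap ⨾ code G ⨾ x₀ ≔ gather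
  ; time  = tick dup ⊕ time F ⊕ tick swap ⊕ time G ⊕ tick gather
  ; space = const 1 ⊕ space F ⊕ space G
  ; runs  = λ x s → exec-assign dup (cons x s) ⨟ runs F x (cons x s)
      ⨟ exec-assign swap (cons _ (cons x s)) ⨟ runs G x (cons _ s)
      ⨟ exec-assign gather (cons _ (cons _ s))
  ; fits  = λ x → s≤s (+-mono-≤ (fits F x) (fits G x)) }

ite : Tree → Tree → Tree → Tree
ite nil        s t = t
ite (cons _ _) s t = s

size-ite : ∀ c {s t b} → size s ≤ b → size t ≤ b → size (ite c s t) ≤ b
size-ite nil        s≤ t≤ = t≤
size-ite (cons _ _) s≤ t≤ = s≤

branch : PolyTime h → PolyTime f → PolyTime g → PolyTime (λ x → ite (h x) (f x) (g x))
branch {h} {f} {g} H F G = record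
  { code  = x₀ ≔ dup ⨾ code H ⨾ if hd v₀ then (x₀ ≔ tl v₀ ⨾ code F) else (x₀ ≔ tl v₀ ⨾ code G)
  ; time  = tick dup ⊕ time H ⊕ tick (hd v₀) ⊕ tick (tl v₀) ⊕ time F ⊕ time G
  ; space = space F ⊕ space G
  ; runs  = λ x s → exec-assign dup (cons x s) ⨟ runs H x (cons x s) ⨟ choose (h x) x s
  ; fits  = λ x → size-ite (h x) (≤-trans (fits F x) (m≤m+n _ _)) (≤-trans (fits G x) (m≤n+m _ _)) }
  where
  choose : ∀ c x s →
    Exec (if hd v₀ then (x₀ ≔ tl v₀ ⨾ code F) else (x₀ ≔ tl v₀ ⨾ code G))
      (cons c (cons x s)) (cons (ite c (f x) (g x)) s)
      (suc (cost {1} (hd v₀)) + (suc (cost {1} (tl v₀)) + (⟦ time F ⟧ (size x) + ⟦ time G ⟧ (size x))))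
  choose nil x s with exec r r≤ ← exec-assign (tl v₀) (cons nil (cons x s)) ⨟ runs G x s =
    exec (if-false refl r)
      (s≤s (+-monoʳ-≤ (cost {1} (hd v₀)) (≤-trans r≤ (+-monoʳ-≤ (suc (cost {1} (tl v₀))) (m≤n+m _ _)))))
  choose (cons c d) x s with exec r r≤ ← exec-assign (tl v₀) (cons (cons c d) (cons x s)) ⨟ runs F x s =
    exec (if-true (λ ()) r)
      (s≤s (+-monoʳ-≤ (cost {1} (hd v₀)) (≤-trans r≤ (+-monoʳ-≤ (suc (cost {1} (tl v₀))) (m≤m+n _ _)))))

-- Folds over lists.

-- The step function of a fold receives a parameter, an entry and the accumulator.
foldlᵗ : (Tree → Tree) → Tree → Tree → Tree → Tree
foldlᵗ f r a nil        = a
foldlᵗ f r a (cons e l) = foldlᵗ f r (f (cons r (cons e a))) l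

foldrᵗ : (Tree → Tree) → Tree → Tree → Tree → Tree
foldrᵗ f r a nil        = a
foldrᵗ f r a (cons e l) = f (cons r (cons e (foldrᵗ f r a l)))

-- Iterating a polynomial-time step can make the accumulator grow exponentially, so a fold needs an
-- a priori bound on everything fed to its step.
Bounded : (Tree → Tree) → Tree → Tree → Tree → ℕ → Set
Bounded f r a nil        b = size a ≤ b
Bounded f r a (cons e l) b =
  size (cons r (cons e a)) ≤ b × Bounded f r (f (cons r (cons e a))) l b

bounded-result : ∀ f r a l {b} → Bounded f r a l b → size (foldlᵗ f r a l) ≤ b
bounded-result f r a nil        a≤b       = a≤b
bounded-result f r a (cons e l) (_ , bnd) = bounded-result f r _ l bnd

module Folding {f r z l : Tree → Tree}
  (F : PolyTime f) (R : PolyTime r) (Z : PolyTime z) (L : PolyTime l)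
  where

  private
    top enter leave finish : Expr 1
    -- The loop works on cons r (cons a l).
    top    = hd v₀
    enter  = cons (cons (hd top) (cons (hd (tl (tl top))) (hd (tl top))))
               (cons (cons (hd top) (tl (tl (tl top)))) (tl v₀))
    leave  = cons (cons (hd (hd (tl v₀))) (cons top (tl (hd (tl v₀))))) (tl (tl v₀))
    finish = cons (hd (tl top)) (tl v₀)

    body loop : Command 1
    body = x₀ ≔ enter ⨾ code F ⨾ x₀ ≔ leave
    loop = while tl (tl top) loop body

    step : ℕ → ℕ
    step b = suc (cost {1} (tl (tl top))) + (suc (cost enter) + (⟦ time F ⟧ b + suc (cost leave)))

    loops : ∀ p a q s b → Bounded f p a q b →
            Exec loop (cons (cons p (cons a q)) s) (cons (cons p (cons (foldlᵗ f p a q) nil)) s)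
              (size q * step b)
    -- `size nil` is 1, which pays for the failing test that ends the loop.
    loops p a nil s b _ =
      exec (loop-exit refl) (≤-trans (m≤m+n (suc (cost {1} (tl (tl top)))) _) (m≤m+n (step b) 0))
    loops p a (cons e q) s b (in≤b , bnd)
      with exec {t} u u≤ ← exec-assign enter (cons (cons p (cons a (cons e q))) s)
             ⨟ weaken (⟦⟧-mono (time F) in≤b) (runs F (cons p (cons e a)) (cons (cons p q) s))
             ⨟ exec-assign leave (cons (f (cons p (cons e a))) (cons (cons p q) s))
         | exec {t′} w w≤ ← loops p (f (cons p (cons e a))) q s b bnd
      = exec (loop-again (λ ()) u w) (begin
          c + (t + t′)                     ≤⟨ +-monoʳ-≤ c (+-mono-≤ u≤ w≤) ⟩
          c + (_ + size q * step b)        ≡⟨ +-assoc c _ (size q * step b) ⟨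
          suc (size q) * step b            ≤⟨ *-monoˡ-≤ (step b) (s≤s (m≤n+m (size q) (size e))) ⟩
          size (cons e q) * step b         ∎)
      where
      open ≤-Reasoning
      c = suc (cost {1} (tl (tl top)))

  foldlₚ : ∀ q → (∀ x → Bounded f (r x) (z x) (l x) (⟦ q ⟧ (size x))) →
           PolyTime (λ x → foldlᵗ f (r x) (z x) (l x))
  foldlₚ q bnd = record
    { code  = code input ⨾ loop ⨾ x₀ ≔ finish
    ; time  = time input
                ⊕ space L ⊗ (tick (tl (tl top)) ⊕ tick enter ⊕ time F ⊚ q ⊕ tick leave)
                ⊕ tick finish
    ; space = q
    ; runs  = λ x s → runs input x s
        ⨟ weaken (*-monoˡ-≤ (step (⟦ q ⟧ (size x))) (fits L x)) (loops (r x) (z x) (l x) s _ (bnd x))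
        ⨟ exec-assign finish _
    ; fits  = λ x → bounded-result f (r x) (z x) (l x) (bnd x) }
    where input = ⟨ R , ⟨ Z , L ⟩ ⟩

open Folding public using (foldlₚ)

reverseOnto : Tree → Tree → Tree
reverseOnto nil        m = m
reverseOnto (cons e l) m = reverseOnto l (cons e m)

reverseᵗ : Tree → Tree
reverseᵗ l = reverseOnto l nil

private
  -- The step receives `cons r (cons e a)`, whose tail is already the accumulator with `e` pushed
  -- onto it.
  push : Expr 1
  push = tl v₀

reverseₚ : PolyTime f → PolyTime (λ x → reverseᵗ (f x))
reverseₚ {f} F = ext (λ x → is-reverse (f x) nil)
  (foldlₚ (expr push) (expr nil) (expr nil) F (const 4 ⊕ space F)
    λ x → bounded (f x) nil (≤-trans (≤-reflexive (+-comm 3 _))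
      (≤-trans (≤-reflexive (trans (+-assoc (size (f x)) 1 3) (+-comm (size (f x)) 4))) (+-monoʳ-≤ 4 (fits F x)))))
  where
  is-reverse : ∀ l m → foldlᵗ (λ x → eval push (x ∷ [])) nil m l ≡ reverseOnto l m
  is-reverse nil        m = refl
  is-reverse (cons e l) m = is-reverse l (cons e m)
  -- Moving an entry from `l` to `m` preserves `size l + size m`; the 3 covers the two `cons` cells
  -- and the `nil` parameter of the step's input.
  bounded : ∀ l m {b} → 3 + (size l + size m) ≤ b → Bounded (λ x → eval push (x ∷ [])) nil m l b
  bounded nil        m le = ≤-trans (m≤n+m (size m) 4) le
  bounded (cons e l) m le =
    ≤-trans (s≤s (s≤s (s≤s (≤-trans (+-monoˡ-≤ (size m) (m≤m+n (size e) (size l))) (n≤1+n _))))) le ,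
    bounded l (cons e m) (≤-trans (≤-reflexive (cong (3 +_)
      (solve 3 (λ a b c → b :+ (con 1 :+ (a :+ c)) := con 1 :+ (a :+ b) :+ c) refl
        (size e) (size l) (size m)))) le)

-- The loop reads lists from the left, so a right fold is run as a left fold over the reversed list.
foldl-reverseOnto : ∀ f r a l m →
  foldlᵗ f r a (reverseOnto l m) ≡ foldlᵗ f r (foldrᵗ f r a l) m
foldl-reverseOnto f r a nil        m = refl
foldl-reverseOnto f r a (cons e l) m = foldl-reverseOnto f r a l (cons e m)

bounded-reverseOnto : ∀ f r a l m {b} →
  (∀ e l′ → size (cons e l′) ≤ size l → size (cons r (cons e (foldrᵗ f r a l′))) ≤ b) →
  Bounded f r (foldrᵗ f r a l) m b → Bounded f r a (reverseOnto l m) b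
bounded-reverseOnto f r a nil        m suffix bnd = bnd
bounded-reverseOnto f r a (cons e l) m suffix bnd =
  bounded-reverseOnto f r a l (cons e m)
    (λ e′ l′ le → suffix e′ l′ (≤-trans le (size-tail (cons e l)))) (suffix e l ≤-refl , bnd)

foldr-size : ∀ f r a b l →
  (∀ e l′ → size (cons e l′) ≤ size l →
    size (f (cons r (cons e (foldrᵗ f r a l′)))) ≤ size (foldrᵗ f r a l′) + b) →
  size (foldrᵗ f r a l) ≤ size a + size l * b
foldr-size f r a b nil        grow = m≤m+n (size a) _
foldr-size f r a b (cons e l) grow = begin
  size (foldrᵗ f r a (cons e l))    ≤⟨ grow e l ≤-refl ⟩
  size (foldrᵗ f r a l) + b         ≤⟨ +-monoˡ-≤ b (foldr-size f r a b l
                                        (λ e′ l′ le → grow e′ l′ (≤-trans le (size-tail (cons e l))))) ⟩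
  size a + size l * b + b           ≡⟨ solve 3 (λ a b l → a :+ l :* b :+ b := a :+ (con 1 :+ l) :* b)
                                         refl (size a) b (size l) ⟩
  size a + suc (size l) * b         ≤⟨ +-monoʳ-≤ (size a) (*-monoˡ-≤ b (s≤s (m≤n+m (size l) (size e)))) ⟩
  size a + size (cons e l) * b      ∎
  where open ≤-Reasoning

-- Growth of the accumulator by a bounded summand per step gives at most the product of that summand
-- with the size of the list. The growth hypothesis is only required for pieces no larger than
-- `l x`, which covers all its suffixes.
foldrₚ : ∀ {r z l} → PolyTime f → PolyTime r → PolyTime z → (L : PolyTime l) → ∀ q →
  (∀ x e l′ → size (cons e l′) ≤ size (l x) →
    size (f (cons (r x) (cons e (foldrᵗ f (r x) (z x) l′)))) ≤
      size (foldrᵗ f (r x) (z x) l′) + ⟦ q ⟧ (size x)) →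
  PolyTime (λ x → foldrᵗ f (r x) (z x) (l x))
foldrₚ {f} {r} {z} {l} F R Z L q grow =
  ext (λ x → foldl-reverseOnto f (r x) (z x) (l x) nil)
    (foldlₚ F R Z (reverseₚ L) bound λ x →
      bounded-reverseOnto f (r x) (z x) (l x) nil
        (λ e l′ le → s≤s (+-mono-≤ (fits R x) (s≤s (+-mono-≤
           (≤-trans (size-head (cons e l′)) (≤-trans le (fits L x)))
           (fold≤ x l′ (≤-trans (size-tail (cons e l′)) le))))))
        (≤-trans (fold≤ x (l x) ≤-refl)
          (≤-trans (m≤n+m _ (⟦ space L ⟧ (size x))) (≤-trans (n≤1+n _)
            (≤-trans (m≤n+m _ (⟦ space R ⟧ (size x))) (n≤1+n _))))))
  where
  foldSpace bound : Poly
  foldSpace = space Z ⊕ space L ⊗ q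
  bound     = const 1 ⊕ space R ⊕ const 1 ⊕ space L ⊕ foldSpace
  fold≤ : ∀ x l′ → size l′ ≤ size (l x) →
          size (foldrᵗ f (r x) (z x) l′) ≤ ⟦ foldSpace ⟧ (size x)
  fold≤ x l′ le = ≤-trans
    (foldr-size f (r x) (z x) (⟦ q ⟧ (size x)) l′ (λ e l″ le′ → grow x e l″ (≤-trans le′ le)))
    (+-mono-≤ (fits Z x) (*-monoˡ-≤ (⟦ q ⟧ (size x)) (≤-trans le (fits L x))))

private
  wrap unwrap : Expr 1
  wrap   = cons v₀ nil
  unwrap = hd v₀

-- The input is wrapped into a stack of one entry. `space F` enters `total` because the size of the
-- output is charged as well.
polynomialTime : ∀ {A B : Set} {encodeA : A → Tree} {encodeB : B → Tree} {k : A → B} →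
  PolyTime f → (∀ x → f (encodeA x) ≡ encodeB (k x)) → PolynomialTime encodeA encodeB k
polynomialTime {f} {encodeA = encodeA} {encodeB} {k} F f≡k
  = 0 , C , a , d , λ x → result x
  where
  total = (tick wrap ⊕ time F ⊕ tick unwrap) ⊕ space F
  a = proj₁ (⟦⟧-bounded total)
  d = proj₁ (proj₂ (⟦⟧-bounded total))
  bound = proj₂ (proj₂ (⟦⟧-bounded total))
  C : Command 1
  C = x₀ ≔ wrap ⨾ code F ⨾ x₀ ≔ unwrap
  positive : ∀ t → ⟦ total ⟧ (size t) ≤ a * size t ^ d
  positive nil        = bound _
  positive (cons _ _) = bound _
  result : ∀ x → ∃[ t ] Σ[ τ ∈ Store 1 ]
    ( Run C (encodeA x ∷ []) t τ × lookup τ zero ≡ encodeB (k x)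
    × t + size (encodeB (k x)) ≤ a * size (encodeA x) ^ d )
  result x with exec {t} run t≤ ← exec-assign wrap (encodeA x) ⨟ runs F (encodeA x) nil ⨟ exec-assign unwrap _ =
    t , _ , run , f≡k x ,
    ≤-trans (+-mono-≤ t≤ (subst (λ y → size y ≤ _) (f≡k x) (fits F (encodeA x))))
      (positive (encodeA x))

-- The kernel

open PolyTime

param entry acc : Tree → Tree
param y = head y
entry y = head (tail y)
acc   y = tail (tail y)

paramₑ entryₑ accₑ : Expr 1
paramₑ = hd v₀
entryₑ = hd (tl v₀)
accₑ = tl (tl v₀)

trueᵗ : Tree
trueᵗ = cons nil nil

trueₚ : PolyTime (λ _ → trueᵗ)
trueₚ = expr (cons nil nil)

nilₚ : PolyTime (λ _ → nil)
nilₚ = expr nil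

notᵗ : Tree → Tree
notᵗ t = ite t nil trueᵗ

notₚ : PolyTime f → PolyTime (λ x → notᵗ (f x))
notₚ F = branch F nilₚ trueₚ

mapᵗ : (Tree → Tree) → Tree → Tree → Tree
mapᵗ f = λ r → foldrᵗ (λ y → cons (f (cons (param y) (entry y))) (acc y)) r nil

mapₚ : PolyTime f → PolyTime r → PolyTime l → PolyTime (λ x → mapᵗ f (r x) (l x))
mapₚ {f} {r} {l} F R L =
  foldrₚ ⟨ F ∘ₚ expr (cons paramₑ entryₑ) , expr accₑ ⟩ R nilₚ L
    (const 1 ⊕ space F ⊚ (const 1 ⊕ space R ⊕ space L)) grow
  where
  grow : ∀ x e l′ → size (cons e l′) ≤ size (l x) →
         size (cons (f (cons (r x) e)) (mapᵗ f (r x) l′)) ≤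
           size (mapᵗ f (r x) l′) + (1 + ⟦ space F ⟧ (1 + (⟦ space R ⟧ (size x) + ⟦ space L ⟧ (size x))))
  grow x e l′ le = ≤-trans
    (s≤s (+-monoˡ-≤ (size (mapᵗ f (r x) l′)) (≤-trans (fits F (cons (r x) e)) (⟦⟧-mono (space F)
      (s≤s (+-mono-≤ (fits R x) (≤-trans (size-head (cons e l′)) (≤-trans le (fits L x)))))))))
    (≤-reflexive (+-comm (1 + ⟦ space F ⟧ _) (size (mapᵗ f (r x) l′))))

-- The accumulator pairs the unread part of the reversed second list with the zipped suffix.
zipStep : Tree → Tree
zipStep y = cons (tail (head (acc y)))
                 (cons (cons (entry y) (head (head (acc y)))) (tail (acc y)))

zipStepₑ : Expr 1
zipStepₑ = cons (tl (hd accₑ)) (cons (cons entryₑ (hd (hd accₑ))) (tl accₑ))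

-- The entries are consumed from the right, hence the reversal.
zipᵗ : Tree → Tree → Tree
zipᵗ s t = tail (foldrᵗ zipStep nil (cons (reverseᵗ t) nil) s)

zipₚ : PolyTime f → PolyTime g → PolyTime (λ x → zipᵗ (f x) (g x))
zipₚ {f} {g} F G = expr (tl v₀) ∘ₚ
  foldrₚ (expr zipStepₑ) nilₚ ⟨ reverseₚ G , nilₚ ⟩ F (const 5 ⊕ space F)
    λ x e l′ le → ≤-trans (grow e (foldrᵗ zipStep nil (cons (reverseᵗ (g x)) nil) l′))
      (+-monoʳ-≤ _ (+-monoʳ-≤ 5 (≤-trans (size-head (cons e l′)) (≤-trans le (fits F x)))))
  where
  grow : ∀ e a → size (zipStep (cons nil (cons e a))) ≤ size a + (5 + size e)
  grow e a = begin
    suc (size (tail (head a)) + suc (suc (size e + size (head (head a))) + size (tail a)))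
      ≡⟨ solve 4 (λ t e h u → con 1 :+ (t :+ (con 1 :+ (con 1 :+ (e :+ h) :+ u)))
                            := con 3 :+ e :+ (h :+ t :+ u)) refl
           (size (tail (head a))) (size e) (size (head (head a))) (size (tail a)) ⟩
    3 + size e + (size (head (head a)) + size (tail (head a)) + size (tail a))
      ≤⟨ +-monoʳ-≤ (3 + size e) (≤-trans (+-monoˡ-≤ _ (size-head-tail (head a)))
           (s≤s (size-head-tail a))) ⟩
    3 + size e + (2 + size a)
      ≡⟨ solve 2 (λ e a → con 3 :+ e :+ (con 2 :+ a) := a :+ (con 5 :+ e)) refl (size e) (size a) ⟩
    size a + (5 + size e) ∎
    where open ≤-Reasoning

-- Matches two entries (a, d) and (b, e) of adjacency matrix rows, d and e
-- marking the diagonal.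
agreeᵗ : Tree → Tree
agreeᵗ p = ite (tail (head p)) trueᵗ (ite (tail (tail p)) trueᵗ
             (ite (head (head p)) (head (tail p)) (notᵗ (head (tail p)))))

agreeₚ : PolyTime f → PolyTime (λ x → agreeᵗ (f x))
agreeₚ F = branch (expr (tl (hd v₀))) trueₚ (branch (expr (tl (tl v₀))) trueₚ
  (branch (expr (hd (hd v₀))) (expr (hd (tl v₀))) (notₚ (expr (hd (tl v₀)))))) ∘ₚ F

sameStep : Tree → Tree
sameStep y = ite (agreeᵗ (entry y)) (acc y) nil

sameᵗ : Tree → Tree → Tree
sameᵗ s t = foldrᵗ sameStep nil trueᵗ (zipᵗ s t)

sameₚ : PolyTime f → PolyTime g → PolyTime (λ x → sameᵗ (f x) (g x))
sameₚ F G = foldrₚ (branch (agreeₚ (expr entryₑ)) (expr accₑ) nilₚ) nilₚ trueₚ (zipₚ F G) (const 0)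
  λ x e l′ _ → ≤-trans
    (size-ite (agreeᵗ e) ≤-refl (1≤size (foldrᵗ sameStep nil trueᵗ l′)))
    (m≤m+n _ 0)

-- The accumulator is a pair of bits, for at least one and at least two hits; a hit shifts the first
-- into the second.
countStep : Tree → Tree
countStep y = ite (sameᵗ (param y) (entry y)) (cons trueᵗ (head (acc y))) (acc y)

twiceᵗ : Tree → Tree → Tree
twiceᵗ u l = tail (foldrᵗ countStep u (cons nil nil) l)

twiceₚ : PolyTime f → PolyTime g → PolyTime (λ x → twiceᵗ (f x) (g x))
twiceₚ {f} F G = expr (tl v₀) ∘ₚ
  foldrₚ (branch (sameₚ (expr paramₑ) (expr entryₑ)) (expr (cons (cons nil nil) (hd accₑ))) (expr accₑ))
    F (expr (cons nil nil)) G (const 4)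
    λ x e l′ _ → let a = foldrᵗ countStep (f x) (cons nil nil) l′ in
      size-ite (sameᵗ (f x) e)
        (≤-trans (+-monoʳ-≤ 4 (size-head a)) (≤-reflexive (+-comm 4 (size a)))) (m≤m+n (size a) 4)

-- A fold step does not see the rest of the list, so the accumulator rebuilds the later rows next to
-- their flags.
flagsStep : Tree → Tree
flagsStep y = cons (cons (entry y) (head (acc y)))
                   (cons (notᵗ (twiceᵗ (entry y) (head (acc y)))) (tail (acc y)))

flagsᵗ : Tree → Tree
flagsᵗ l = tail (foldrᵗ flagsStep nil (cons nil nil) l)

flagsₚ : PolyTime f → PolyTime (λ x → flagsᵗ (f x))
flagsₚ F = expr (tl v₀) ∘ₚ
  foldrₚ ⟨ expr (cons entryₑ (hd accₑ))
         , ⟨ notₚ (twiceₚ (expr entryₑ) (expr (hd accₑ))) , expr (tl accₑ) ⟩ ⟩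
    nilₚ (expr (cons nil nil)) F (const 7 ⊕ space F)
    λ x e l′ le → ≤-trans (grow e (foldrᵗ flagsStep nil (cons nil nil) l′))
      (+-monoʳ-≤ _ (+-monoʳ-≤ 7 (≤-trans (size-head (cons e l′)) (≤-trans le (fits F x)))))
  where
  grow : ∀ e a → size (flagsStep (cons nil (cons e a))) ≤ size a + (7 + size e)
  grow e a = begin
    suc (suc (size e + size (head a)) + suc (size (notᵗ (twiceᵗ e (head a))) + size (tail a)))
      ≤⟨ s≤s (+-monoʳ-≤ (suc (size e + size (head a))) (s≤s (+-monoˡ-≤ (size (tail a))
           (size-ite (twiceᵗ e (head a)) {nil} {trueᵗ} {3} (s≤s z≤n) ≤-refl)))) ⟩
    suc (suc (size e + size (head a)) + suc (3 + size (tail a)))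
      ≡⟨ solve 3 (λ e h t → con 1 :+ (con 1 :+ (e :+ h) :+ (con 1 :+ (con 3 :+ t)))
                          := con 6 :+ e :+ (h :+ t)) refl (size e) (size (head a)) (size (tail a)) ⟩
    6 + size e + (size (head a) + size (tail a))
      ≤⟨ +-monoʳ-≤ (6 + size e) (size-head-tail a) ⟩
    6 + size e + (1 + size a)
      ≡⟨ solve 2 (λ e a → con 6 :+ e :+ (con 1 :+ a) := a :+ (con 7 :+ e)) refl (size e) (size a) ⟩
    size a + (7 + size e) ∎
    where open ≤-Reasoning

filterStep : Tree → Tree
filterStep y = ite (head (entry y)) (cons (tail (entry y)) (acc y)) (acc y)

filterᵗ : Tree → Tree → Tree
filterᵗ m l = foldrᵗ filterStep nil nil (zipᵗ m l)

filterₚ : PolyTime f → PolyTime g → PolyTime (λ x → filterᵗ (f x) (g x))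
filterₚ F G =
  foldrₚ (branch (expr (hd entryₑ)) (expr (cons (tl entryₑ) accₑ)) (expr accₑ)) nilₚ nilₚ Z
    (const 1 ⊕ space Z)
    λ x e l′ le → let a = foldrᵗ filterStep nil nil l′ in
      size-ite (head e)
        (≤-trans (s≤s (+-monoˡ-≤ (size a)
            (≤-trans (size-tail e) (≤-trans (size-head (cons e l′)) (≤-trans le (fits Z x))))))
          (≤-reflexive (+-comm (1 + ⟦ space Z ⟧ (size x)) (size a))))
        (m≤m+n (size a) _)
  where Z = zipₚ F G

-- The argument comes from `mapᵗ`, so its tail is the row and its head the map's parameter.
indent : Tree → Tree
indent z = cons nil (tail z)

zerosᵗ shiftᵗ : Tree → Tree
zerosᵗ = mapᵗ (λ _ → nil) nil
shiftᵗ = mapᵗ indent nil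

-- Borders an identity matrix with a new first row and column; one zero is produced per existing
-- row.
diagonalStep : Tree → Tree
diagonalStep y = cons (cons trueᵗ (zerosᵗ (acc y))) (shiftᵗ (acc y))

diagonalᵗ : Tree → Tree
diagonalᵗ = foldrᵗ diagonalStep nil nil

len : Tree → ℕ
len nil        = 0
len (cons _ l) = suc (len l)

len≤size : ∀ l → len l ≤ size l
len≤size nil        = z≤n
len≤size (cons e l) = s≤s (≤-trans (len≤size l) (m≤n+m (size l) (size e)))

len-map : ∀ f r l → len (mapᵗ f r l) ≡ len l
len-map f r nil        = refl
len-map f r (cons e l) = cong suc (len-map f r l)

len-diagonal : ∀ l → len (diagonalᵗ l) ≡ len l
len-diagonal nil        = refl
len-diagonal (cons e l) = cong suc (trans (len-map indent nil (diagonalᵗ l)) (len-diagonal l))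

size-zeros : ∀ l → size (zerosᵗ l) ≡ 1 + 2 * len l
size-zeros nil        = refl
size-zeros (cons e l) = trans (cong (2 +_) (size-zeros l))
  (solve 1 (λ k → con 2 :+ (con 1 :+ con 2 :* k) := con 1 :+ con 2 :* (con 1 :+ k)) refl (len l))

size-shift : ∀ l → size (shiftᵗ l) ≡ size l + 2 * len l
size-shift nil        = refl
size-shift (cons e l) = trans (cong (λ k → suc (suc (suc (size e)) + k)) (size-shift l))
  (solve 3 (λ e l k → con 1 :+ (con 1 :+ (con 1 :+ e) :+ (l :+ con 2 :* k))
                    := con 1 :+ (e :+ l) :+ con 2 :* (con 1 :+ k)) refl (size e) (size l) (len l))

-- Indenting enlarges every row, but only by a constant, so a step still adds just a linear amount;
-- the sizes are computed exactly to see this.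
diagonalₚ : PolyTime f → PolyTime (λ x → diagonalᵗ (f x))
diagonalₚ {f} F =
  foldrₚ ⟨ ⟨ trueₚ , mapₚ nilₚ nilₚ (expr accₑ) ⟩
         , mapₚ (expr (cons nil (tl v₀))) nilₚ (expr accₑ) ⟩
    nilₚ nilₚ F (const 6 ⊕ const 4 ⊗ space F) grow
  where
  grow : ∀ x e l′ → size (cons e l′) ≤ size (f x) →
         size (diagonalᵗ (cons e l′)) ≤ size (diagonalᵗ l′) + (6 + 4 * ⟦ space F ⟧ (size x))
  grow x e l′ le = begin
    suc (suc (3 + size (zerosᵗ a)) + size (shiftᵗ a))
      ≡⟨ cong₂ (λ z s → suc (suc (3 + z) + s)) (size-zeros a) (size-shift a) ⟩
    suc (suc (3 + (1 + 2 * len a)) + (size a + 2 * len a))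
      ≡⟨ solve 2 (λ k a → con 1 :+ (con 1 :+ (con 3 :+ (con 1 :+ con 2 :* k)) :+ (a :+ con 2 :* k))
                        := a :+ (con 6 :+ con 4 :* k)) refl (len a) (size a) ⟩
    size a + (6 + 4 * len a)
      ≤⟨ +-monoʳ-≤ (size a) (+-monoʳ-≤ 6 (*-monoʳ-≤ 4 len-a)) ⟩
    size a + (6 + 4 * ⟦ space F ⟧ (size x)) ∎
    where
    open ≤-Reasoning
    a = diagonalᵗ l′
    len-a : len a ≤ ⟦ space F ⟧ (size x)
    len-a = ≤-trans (≤-reflexive (len-diagonal l′)) (≤-trans (len≤size l′)
              (≤-trans (size-tail (cons e l′)) (≤-trans le (fits F x))))

markRow : Tree → Tree
markRow z = zipᵗ (head (tail z)) (tail (tail z))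

-- Pairing each row with its unit vector lets two rows be compared away from their own two positions
-- without any handling of vertex indices.
markedᵗ : Tree → Tree
markedᵗ rows = mapᵗ markRow nil (zipᵗ rows (diagonalᵗ rows))

markedₚ : PolyTime f → PolyTime (λ x → markedᵗ (f x))
markedₚ F = mapₚ (zipₚ (expr (hd (tl v₀))) (expr (tl (tl v₀)))) nilₚ (zipₚ F (diagonalₚ F))

filterRow : Tree → Tree
filterRow z = filterᵗ (head z) (tail z)

submatrixᵗ : Tree → Tree → Tree
submatrixᵗ m rows = mapᵗ filterRow m (filterᵗ m rows)

submatrixₚ : PolyTime f → PolyTime g → PolyTime (λ x → submatrixᵗ (f x) (g x))
submatrixₚ F G = mapₚ (filterₚ (expr (hd v₀)) (expr (tl v₀))) F (filterₚ F G)

kernelᵗ : Tree → Tree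
kernelᵗ x = cons (head x) (submatrixᵗ (flagsᵗ (markedᵗ (tail x))) (tail x))

kernelₚ : PolyTime kernelᵗ
kernelₚ = ⟨ expr (hd v₀) , submatrixₚ (flagsₚ (markedₚ (expr (tl v₀)))) (expr (tl v₀)) ⟩

-- Correctness of the kernel program.

table : (Fin n → Tree) → Tree
table f = encodeList (tabulate f)

table-cong : ∀ {f g : Fin n → Tree} → (∀ i → f i ≡ g i) → table f ≡ table g
table-cong f≡g = cong encodeList (tabulate-cong f≡g)

map-table : ∀ f r (h : Fin n → Tree) → mapᵗ f r (table h) ≡ table (λ i → f (cons r (h i)))
map-table {zero}  f r h = refl
map-table {suc n} f r h = cong (cons _) (map-table f r (h ∘ suc))

zip-table : ∀ (f g : Fin n → Tree) → zipᵗ (table f) (table g) ≡ table (λ i → cons (f i) (g i))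
zip-table f g = cong tail (go f g nil)
  where
  go : ∀ {n} (f g : Fin n → Tree) m →
       -- Generalized over `m`: the reversal puts the entries of `g` in front of `m`, and the fold
       -- pops exactly these, last entry first.
       foldrᵗ zipStep nil (cons (reverseOnto (table g) m) nil) (table f) ≡
         cons m (table (λ i → cons (f i) (g i)))
  go {zero}  f g m = refl
  go {suc n} f g m = cong (λ a → zipStep (cons nil (cons (f zero) a)))
                       (go (f ∘ suc) (g ∘ suc) (cons (g zero) m))

agrees : Bool → Bool → Bool → Bool → Bool
agrees a d b e = d ∨ (e ∨ does (a Bool.≟ b))

agree-correct : ∀ a d b e →
  agreeᵗ (cons (cons (encodeBool a) (encodeBool d)) (cons (encodeBool b) (encodeBool e))) ≡
    encodeBool (agrees a d b e)
agree-correct a     true  b     e     = refl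
agree-correct a     false b     true  = refl
agree-correct false false false false = refl
agree-correct false false true  false = refl
agree-correct true  false false false = refl
agree-correct true  false true  false = refl

every : (Fin n → Bool) → Bool
every {zero}  b = true
every {suc n} b = b zero ∧ every (b ∘ suc)

same-correct : ∀ (a d b e : Fin n → Bool) →
  sameᵗ (table λ i → cons (encodeBool (a i)) (encodeBool (d i)))
        (table λ i → cons (encodeBool (b i)) (encodeBool (e i))) ≡
    encodeBool (every λ i → agrees (a i) (d i) (b i) (e i))
same-correct a d b e = trans (cong (foldrᵗ sameStep nil trueᵗ)
    (zip-table (λ i → cons (encodeBool (a i)) (encodeBool (d i)))
               (λ i → cons (encodeBool (b i)) (encodeBool (e i)))))
  (go a d b e)
  where
  go : ∀ {n} (a d b e : Fin n → Bool) →
    foldrᵗ sameStep nil trueᵗ (table λ i → cons (cons (encodeBool (a i)) (encodeBool (d i)))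
                                                (cons (encodeBool (b i)) (encodeBool (e i)))) ≡
      encodeBool (every λ i → agrees (a i) (d i) (b i) (e i))
  go {zero}  a d b e = refl
  go {suc n} a d b e
    rewrite agree-correct (a zero) (d zero) (b zero) (e zero)
          | go (a ∘ suc) (d ∘ suc) (b ∘ suc) (e ∘ suc)
    with agrees (a zero) (d zero) (b zero) (e zero)
  ... | true  = refl
  ... | false = refl

once twice : (Fin n → Bool) → Bool
once {zero}  b = false
once {suc n} b = b zero ∨ once (b ∘ suc)
twice {zero}  b = false
twice {suc n} b = Bool.if b zero then once (b ∘ suc) else twice (b ∘ suc)

twice-correct : ∀ u (h : Fin n → Tree) (b : Fin n → Bool) →
  (∀ i → sameᵗ u (h i) ≡ encodeBool (b i)) →
  foldrᵗ countStep u (cons nil nil) (table h) ≡ cons (encodeBool (once b)) (encodeBool (twice b))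
twice-correct {zero}  u h b eq = refl
twice-correct {suc n} u h b eq
  rewrite eq zero | twice-correct u (h ∘ suc) (b ∘ suc) (eq ∘ suc) with b zero
... | true  = refl
... | false = refl

-- The recursion follows `flagsStep`: a vertex is judged against all later ones, whether or not
-- these are kept themselves.
keep : (Fin n → Fin n → Bool) → Subset n
keep {zero}  s = []
keep {suc n} s = not (twice (s zero ∘ suc)) ∷ keep (λ i j → s (suc i) (suc j))

not-correct : ∀ b → notᵗ (encodeBool b) ≡ encodeBool (not b)
not-correct false = refl
not-correct true  = refl

flags-correct : ∀ (h : Fin n → Tree) (s : Fin n → Fin n → Bool) →
  (∀ i j → sameᵗ (h i) (h j) ≡ encodeBool (s i j)) →
  flagsᵗ (table h) ≡ table (encodeBool ∘ lookup (keep s))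
flags-correct h s eq = cong tail (go h s eq)
  where
  go : ∀ {n} (h : Fin n → Tree) (s : Fin n → Fin n → Bool) →
    (∀ i j → sameᵗ (h i) (h j) ≡ encodeBool (s i j)) →
    foldrᵗ flagsStep nil (cons nil nil) (table h) ≡
      cons (table h) (table (encodeBool ∘ lookup (keep s)))
  go {zero}  h s eq = refl
  go {suc n} h s eq = trans
    (cong (λ a → flagsStep (cons nil (cons (h zero) a))) (go (h ∘ suc) _ (λ i j → eq (suc i) (suc j))))
    (cong (λ t → cons (table h) (cons t _)) (trans
      (cong (notᵗ ∘ tail) (twice-correct (h zero) (h ∘ suc) (s zero ∘ suc) (eq zero ∘ suc)))
      (not-correct (twice (s zero ∘ suc)))))

filter-correct : ∀ (S : Subset n) (h : Fin n → Tree) →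
  filterᵗ (table (encodeBool ∘ lookup S)) (table h) ≡ table (h ∘ embed S)
filter-correct S h = trans (cong (foldrᵗ filterStep nil nil) (zip-table (encodeBool ∘ lookup S) h)) (go S h)
  where
  go : ∀ {n} (S : Subset n) (h : Fin n → Tree) →
    foldrᵗ filterStep nil nil (table λ i → cons (encodeBool (lookup S i)) (h i)) ≡
      table (h ∘ embed S)
  go []          h = refl
  go (true  ∷ S) h = cong (cons (h zero)) (go S (h ∘ suc))
  go (false ∷ S) h = go S (h ∘ suc)

unit : Fin n → Fin n → Tree
unit i j = encodeBool (does (i Fin.≟ j))

diagonal-correct : ∀ (h : Fin n → Tree) → diagonalᵗ (table h) ≡ table λ i → table (unit {n} i)
diagonal-correct {zero}  h = refl
diagonal-correct {suc n} h = trans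
  (cong (λ a → diagonalStep (cons nil (cons (h zero) a))) (diagonal-correct (h ∘ suc)))
  (cong₂ (λ zs ts → cons (cons trueᵗ zs) ts)
    (map-table (λ _ → nil) nil (λ i → table (unit {n} i)))
    (map-table indent nil (λ i → table (unit {n} i))))

submatrix-correct : ∀ (S : Subset n) (h : Fin n → Fin n → Tree) →
  submatrixᵗ (table (encodeBool ∘ lookup S)) (table λ i → table (h i)) ≡
    table λ i → table λ j → h (embed S i) (embed S j)
submatrix-correct S h = trans (cong (mapᵗ filterRow m) (filter-correct S (λ i → table (h i))))
  (trans (map-table filterRow m (λ i → table (h (embed S i))))
    (table-cong {f = λ i → filterᵗ m (table (h (embed S i)))} λ i → filter-correct S (h (embed S i))))
  where m = table (encodeBool ∘ lookup S)

adjacent : Graph n → Fin n → Fin n → Bool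
adjacent G u v = lookup (N G u) v

alike : Graph n → Fin n → Fin n → Bool
alike G u v = every λ x →
  agrees (adjacent G u x) (does (u Fin.≟ x)) (adjacent G v x) (does (v Fin.≟ x))

kernel : Instance → Instance
kernel I = record
  { order = ∣ keep (alike (graph I)) ∣
  ; graph = induced (graph I) (keep (alike (graph I)))
  ; first = first I }

bit : Graph n → Fin n → Fin n → Tree
bit G u v = encodeBool (adjacent G u v)

matrix : Graph n → Tree
matrix G = table λ u → table (bit G u)

encode-matrix : ∀ I → encode I ≡ cons (encodePlayer (first I)) (matrix (graph I))
encode-matrix I = cong (cons (encodePlayer (first I))) (table-cong λ v → cong encodeList
  (trans (cong (map encodeBool) (sym (tabulate∘lookup (N (graph I) v))))
    (sym (tabulate-∘ encodeBool (lookup (N (graph I) v))))))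

marked : Graph n → Fin n → Tree
marked G u = table λ x → cons (bit G u x) (unit u x)

marked-correct : ∀ (G : Graph n) → markedᵗ (matrix G) ≡ table (marked G)
marked-correct {n} G = trans
  (cong (mapᵗ markRow nil) (trans
    (cong (zipᵗ (matrix G)) (diagonal-correct (λ u → table (bit G u))))
    (zip-table (λ u → table (bit G u)) (λ u → table (unit u)))))
  (trans (map-table markRow nil (λ u → cons (table (bit G u)) (table (unit u))))
    (table-cong λ u → zip-table (bit G u) (unit u)))

kernel-correct : ∀ I → kernelᵗ (encode I) ≡ encode (kernel I)
kernel-correct I = trans (cong kernelᵗ (encode-matrix I))
  (trans (cong (cons (encodePlayer (first I))) rows) (sym (encode-matrix (kernel I))))
  where
  open ≡-Reasoning
  G = graph I
  S = keep (alike G)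
  rows : submatrixᵗ (flagsᵗ (markedᵗ (matrix G))) (matrix G) ≡ matrix (induced G S)
  rows = begin
    submatrixᵗ (flagsᵗ (markedᵗ (matrix G))) (matrix G)
      ≡⟨ cong (λ t → submatrixᵗ (flagsᵗ t) (matrix G)) (marked-correct G) ⟩
    submatrixᵗ (flagsᵗ (table (marked G))) (matrix G)
      ≡⟨ cong (λ m → submatrixᵗ m (matrix G)) (flags-correct (marked G) (alike G)
           (λ u v → same-correct (adjacent G u) (λ x → does (u Fin.≟ x))
                                 (adjacent G v) (λ x → does (v Fin.≟ x)))) ⟩
    submatrixᵗ (table (encodeBool ∘ lookup S)) (matrix G)
      ≡⟨ submatrix-correct S (bit G) ⟩
    (table λ i → table λ j → bit G (embed S i) (embed S j))
      ≡⟨ table-cong (λ i → table-cong λ j → cong encodeBool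
           (sym (lookup∘tabulate (λ k → adjacent G (embed S i) (embed S k)) j))) ⟩
    matrix (induced G S) ∎

kernel-polynomial : PolynomialTime encode encode kernel
kernel-polynomial = polynomialTime {encodeA = encode} {encode} {kernel} kernelₚ kernel-correct

-- Vertex types and the size of the kernel.

every⁻ : ∀ (b : Fin n → Bool) → every b ≡ true → ∀ i → b i ≡ true
every⁻ {suc n} b eq i with b zero in eq₀
every⁻ b eq zero    | true = eq₀
every⁻ b eq (suc i) | true = every⁻ (b ∘ suc) eq i

every⁺ : ∀ (b : Fin n → Bool) → (∀ i → b i ≡ true) → every b ≡ true
every⁺ {zero}  b all = refl
every⁺ {suc n} b all rewrite all zero = every⁺ (b ∘ suc) (all ∘ suc)

-- The pointwise form of `SameType`. At the two exempt positions both sets in `SameType` lack the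
-- vertex anyway, by irreflexivity on one side and removal on the other.
Agree : Graph n → Fin n → Fin n → Set
Agree G u v = ∀ x → x ≢ u → x ≢ v → adjacent G u x ≡ adjacent G v x

alike⁻ : ∀ (G : Graph n) u v → alike G u v ≡ true → Agree G u v
alike⁻ G u v eq x x≢u x≢v with every⁻ _ eq x
... | agr with u Fin.≟ x | v Fin.≟ x
...   | yes u≡x | _       = contradiction (sym u≡x) x≢u
...   | no _    | yes v≡x = contradiction (sym v≡x) x≢v
...   | no _    | no _ with adjacent G u x Bool.≟ adjacent G v x
...     | yes a≡b = a≡b

alike⁺ : ∀ (G : Graph n) u v → Agree G u v → alike G u v ≡ true
alike⁺ G u v agr = every⁺ _ at
  where
  at : ∀ x → agrees (adjacent G u x) (does (u Fin.≟ x)) (adjacent G v x) (does (v Fin.≟ x)) ≡ true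
  at x with u Fin.≟ x | v Fin.≟ x
  ... | yes _  | _     = refl
  ... | no _   | yes _ = refl
  ... | no u≢x | no v≢x with adjacent G u x Bool.≟ adjacent G v x
  ...   | yes _  = refl
  ...   | no a≢b = contradiction (agr x (≢-sym u≢x) (≢-sym v≢x)) a≢b

agree-sym : ∀ (G : Graph n) {u v} → Agree G u v → Agree G v u
agree-sym G agr x x≢v x≢u = sym (agr x x≢u x≢v)

adjacent-sym : ∀ (G : Graph n) u v → adjacent G u v ≡ adjacent G v u
adjacent-sym G u v with adjacent G u v in uv | adjacent G v u in vu
... | true  | true  = refl
... | false | false = refl
... | true  | false =
  contradiction (trans (sym vu) ([]=⇒lookup (symmetric G (lookup⇒[]= v (N G u) uv)))) λ ()
... | false | true  =
  contradiction (trans (sym uv) ([]=⇒lookup (symmetric G (lookup⇒[]= u (N G v) vu)))) λ ()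

-- Only the position `v` is delicate, as both hypotheses exempt it. There symmetry of adjacency
-- shows that the three pairs among `u`, `v`, `w` are all adjacent or all nonadjacent.
agree-trans : ∀ (G : Graph n) {u v w} → u ≢ v → v ≢ w → u ≢ w →
              Agree G u v → Agree G v w → Agree G u w
agree-trans G {u} {v} {w} u≢v v≢w u≢w uv vw x x≢u x≢w with x Fin.≟ v
... | no  x≢v  = trans (uv x x≢u x≢v) (vw x x≢v x≢w)
... | yes refl = begin
  adjacent G u v ≡⟨ adjacent-sym G u v ⟩
  adjacent G v u ≡⟨ vw u u≢v u≢w ⟩
  adjacent G w u ≡⟨ adjacent-sym G w u ⟩
  adjacent G u w ≡⟨ uv w (≢-sym u≢w) (≢-sym v≢w) ⟩
  adjacent G v w ≡⟨ adjacent-sym G v w ⟩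
  adjacent G w v ∎
  where open ≡-Reasoning

sameType⇒agree : ∀ (G : Graph n) {u v} → SameType G u v → Agree G u v
sameType⇒agree G {u} {v} same x x≢u x≢v with adjacent G u x in ux | adjacent G v x in vx
... | true  | true  = refl
... | false | false = refl
... | true  | false = contradiction
  (trans (sym vx) ([]=⇒lookup (sameType-∈ G same x≢u x≢v (lookup⇒[]= x (N G u) ux)))) λ ()
... | false | true  = contradiction
  (trans (sym ux) ([]=⇒lookup (sameType-∈ G (sym same) x≢v x≢u (lookup⇒[]= x (N G v) vx)))) λ ()

x∉p-x : ∀ (p : Subset n) x → x ∉ p - x
x∉p-x p x x∈ = ⊂-irref (p─q─q≡p─q p ⁅ x ⁆) (x∈p⇒p-x⊂p x∈)

agree⇒sameType : ∀ (G : Graph n) {u v} → Agree G u v → SameType G u v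
agree⇒sameType {n} G {u} {v} agr = ⊆-antisym (half agr) (half (agree-sym G agr))
  where
  half : ∀ {u v} → Agree G u v → N G u - v ⊆ N G v - u
  half {u} {v} agr {x} x∈ = x∈p∧x≢y⇒x∈p-y
    (lookup⇒[]= x _ (trans (sym (agr x x≢u x≢v)) ([]=⇒lookup x∈u))) x≢u
    where
    x∈u : x ∈ N G u
    x∈u = p─q⊆p (N G u) ⁅ v ⁆ x∈
    x≢u : x ≢ u
    x≢u refl = irreflexive G x∈u
    x≢v : x ≢ v
    x≢v refl = x∉p-x (N G u) v x∈

once⁻ : ∀ (b : Fin n → Bool) → once b ≡ true → ∃[ i ] b i ≡ true
once⁻ {suc n} b eq with b zero in eq₀
... | true  = zero , eq₀
... | false with i , bi ← once⁻ (b ∘ suc) eq = suc i , bi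

once⁺ : ∀ (b : Fin n → Bool) i → b i ≡ true → once b ≡ true
once⁺ b zero    eq rewrite eq = refl
once⁺ b (suc i) eq with b zero
... | true  = refl
... | false = once⁺ (b ∘ suc) i eq

twice⁻ : ∀ (b : Fin n → Bool) → twice b ≡ true →
         ∃[ i ] ∃[ j ] (i Fin.< j × b i ≡ true × b j ≡ true)
twice⁻ {suc n} b eq with b zero in eq₀
... | true  with j , bj ← once⁻ (b ∘ suc) eq = zero , suc j , s≤s z≤n , eq₀ , bj
... | false with i , j , i<j , bi , bj ← twice⁻ (b ∘ suc) eq = suc i , suc j , s≤s i<j , bi , bj

twice⁺ : ∀ (b : Fin n → Bool) i j → i Fin.< j → b i ≡ true → b j ≡ true → twice b ≡ true
twice⁺ b zero    (suc j) _         bi bj rewrite bi = once⁺ (b ∘ suc) j bj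
twice⁺ b (suc i) (suc j) (s≤s i<j) bi bj with b zero
... | true  = once⁺ (b ∘ suc) i bi
... | false = twice⁺ (b ∘ suc) i j i<j bi bj

keep⁻ : ∀ (s : Fin n → Fin n → Bool) v → lookup (keep s) v ≡ false →
        ∃[ a ] ∃[ b ] (v Fin.< a × a Fin.< b × s v a ≡ true × s v b ≡ true)
keep⁻ s zero eq
  with a , b , a<b , sa , sb ← twice⁻ (s zero ∘ suc) (Bool.not-injective eq) =
  suc a , suc b , s≤s z≤n , s≤s a<b , sa , sb
keep⁻ s (suc v) eq
  with a , b , v<a , a<b , sa , sb ← keep⁻ (λ i j → s (suc i) (suc j)) v eq =
  suc a , suc b , s≤s v<a , s≤s a<b , sa , sb

keep⁺ : ∀ (s : Fin n → Fin n → Bool) v a b → v Fin.< a → a Fin.< b →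
        s v a ≡ true → s v b ≡ true → lookup (keep s) v ≡ false
keep⁺ s zero    (suc a) (suc b) v<a       (s≤s a<b) sa sb =
  cong not (twice⁺ (s zero ∘ suc) a b a<b sa sb)
keep⁺ s (suc v) (suc a) (suc b) (s≤s v<a) (s≤s a<b) sa sb =
  keep⁺ (λ i j → s (suc i) (suc j)) v a b v<a a<b sa sb

kernel-twins : ∀ (G : Graph n) v → lookup (keep (alike G)) v ≡ false → LaterTwins G v
kernel-twins G v eq
  with a , b , v<a , a<b , va , vb ← keep⁻ (alike G) v eq =
  record { a = a ; b = b ; v<a = v<a ; a<b = a<b
         ; v~a = agree⇒sameType G va′ ; v~b = agree⇒sameType G vb′
         ; a~b = agree⇒sameType G (agree-trans G (≢-sym v≢a) v≢b (Fin.<⇒≢ a<b) (agree-sym G va′) vb′) }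
  where
  va′ = alike⁻ G v a va
  vb′ = alike⁻ G v b vb
  v≢a = Fin.<⇒≢ v<a
  v≢b = Fin.<⇒≢ (Fin.<-trans v<a a<b)

-- A kept vertex is labeled by its part and by whether it is the last vertex of that part. If two
-- kept vertices shared a label, the earlier would have a later vertex in its part, hence so would
-- the other, and the earlier would have two later twins and be deleted.
kept-bound : ∀ (G : Graph n) {w} → TypePartition G w → ∣ keep (alike G) ∣ ≤ w * 2
kept-bound {n} G {w} π = Fin.injective⇒≤ {f = label} label-injective
  where
  open TypePartition π
  S = keep (alike G)

  Later : Fin n → Fin n → Set
  Later x z = x Fin.< z × part x ≡ part z

  later? : ∀ x → Dec (∃[ z ] Later x z)
  later? x = Fin.any? λ z → (x Fin.<? z) ×-dec (part x Fin.≟ part z)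

  rank : ∀ {A : Set} → Dec A → Fin 2
  rank (yes _) = zero
  rank (no _)  = suc zero

  label : Fin ∣ S ∣ → Fin (w * 2)
  label i = combine (part (embed S i)) (rank (later? (embed S i)))

  alike-part : ∀ {x y} → part x ≡ part y → alike G x y ≡ true
  alike-part {x} {y} eq = alike⁺ G x y (sameType⇒agree G (sameType x y eq))

  clash : ∀ i j → embed S i Fin.< embed S j → part (embed S i) ≡ part (embed S j) →
          rank (later? (embed S i)) ≢ rank (later? (embed S j))
  clash i j x<y px≡py eq with later? (embed S i) | later? (embed S j)
  ... | no ∄z | _ = ∄z (embed S j , x<y , px≡py)
  ... | yes _ | no _ with () ← eq
  ... | yes _ | yes (z , y<z , py≡pz) = contradiction
    (trans (sym (lookup-embed S i))
      (keep⁺ (alike G) (embed S i) (embed S j) z x<y y<z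
        (alike-part px≡py) (alike-part (trans px≡py py≡pz)))) λ ()

  label-injective : ∀ {i j} → label i ≡ label j → i ≡ j
  label-injective {i} {j} eq
    with parts , ranks ← Fin.combine-injective (part (embed S i)) _ (part (embed S j)) _ eq
    with Fin.<-cmp (embed S i) (embed S j)
  ... | tri< x<y _ _ = contradiction ranks (clash i j x<y parts)
  ... | tri≈ _ x≡y _ = embed-injective S x≡y
  ... | tri> _ _ y<x = contradiction (sym ranks) (clash j i y<x (sym parts))

theorem4p2 :
    Σ[ kernel ∈ (Instance → Instance) ]
      ( PolynomialTime encode encode kernel
      × (∀ I → SameWinner I (kernel I))
      × ∃[ c ] (∀ I w → IsNeighborhoodDiversity (graph I) w → order (kernel I) ≤ c * w) )
theorem4p2 = kernel , kernel-polynomial , same-winner , 2 , λ I w (π , _) →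
    ≤-trans (kept-bound (graph I) π) (≤-reflexive (*-comm w 2))
  where
  same-winner : ∀ I → SameWinner I (kernel I)
  same-winner I = Deletion.sameWinner (order I) (graph I) (keep (alike (graph I)))
    (kernel-twins (graph I)) (first I)
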